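{- Let $G$ be a finite simple undirected graph that contains no induced subgraph isomorphic to the Chair and no induced subgraph isomorphic to the Kite. Then $\chi(G) \leq \left\lceil \frac{\Delta(G) + \omega(G) + 1}{2} \right\rceil$.
   Context: $\chi(G)$, $\Delta(G)$, $\omega(G)$ denote the chromatic number, maximum degree and clique number of $G$. The Chair (also called fork) is the 5-vertex graph obtained from the star $K_{1,3}$ by subdividing one edge once (vertices $a,b,c,d,e$ with edges $ab, bc, bd, de$). The Kite is the complement of the Chair: the 5-vertex graph obtained from the diamond $K_4 - e$ by adding a new vertex adjacent to exactly one of the two degree-2 vertices of the diamond. "Contains no induced subgraph isomorphic to $F$" means no subset of vertices of $G$ induces a graph isomorphic to $F$. -}

module Defs where

open import Data.Nat using (ℕ; _⊔_; _≤_)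
open import Data.Bool using (Bool; true; false; not; _∧_; T)
open import Data.Fin using (Fin; zero; suc)
open import Data.Fin.Subset using (Subset; _∈_; ∣_∣)
open import Data.Vec using (tabulate)
open import Data.List using (foldr; map; allFin)
open import Data.Product using (Σ; _×_)
open import Function.Definitions using (Injective)
open import Relation.Binary.PropositionalEquality using (_≡_; _≢_)

record Graph (n : ℕ) : Set where
  field
    adj       : Fin n → Fin n → Bool
    adj-sym   : ∀ u v → adj u v ≡ adj v u
    adj-irrefl : ∀ v → adj v v ≡ false
open Graph public

nbhd : ∀ {n} → Graph n → Fin n → Subset n
nbhd G v = tabulate (adj G v)

degree : ∀ {n} → Graph n → Fin n → ℕ
degree G v = ∣ nbhd G v ∣

-- Maximum degree Δ(G) (0 for the empty graph).
maxDegree : ∀ {n} → Graph n → ℕ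
maxDegree {n} G = foldr _⊔_ 0 (map (degree G) (allFin n))

IsClique : ∀ {n} → Graph n → Subset n → Set
IsClique G S = ∀ u v → u ∈ S → v ∈ S → u ≢ v → adj G u v ≡ true

IsCliqueNumber : ∀ {n} → Graph n → ℕ → Set
IsCliqueNumber G ω =
  Σ (Subset _) (λ S → IsClique G S × ∣ S ∣ ≡ ω)
  × (∀ S → IsClique G S → ∣ S ∣ ≤ ω)

-- Proper colourings with k colours; χ(G) ≤ k iff G is k-colourable.
IsProperColouring : ∀ {n k} → Graph n → (Fin n → Fin k) → Set
IsProperColouring G c = ∀ u v → adj G u v ≡ true → c u ≢ c v

Colourable : ∀ {n} → Graph n → ℕ → Set
Colourable {n} G k = Σ (Fin n → Fin k) (IsProperColouring G)

-- The Chair (fork): vertices a=0,b=1,c=2,d=3,e=4, edges ab, bc, bd, de.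
chairAdj : Fin 5 → Fin 5 → Bool
chairAdj zero (suc zero) = true
chairAdj (suc zero) zero = true
chairAdj (suc zero) (suc (suc zero)) = true
chairAdj (suc (suc zero)) (suc zero) = true
chairAdj (suc zero) (suc (suc (suc zero))) = true
chairAdj (suc (suc (suc zero))) (suc zero) = true
chairAdj (suc (suc (suc zero))) (suc (suc (suc (suc zero)))) = true
chairAdj (suc (suc (suc (suc zero)))) (suc (suc (suc zero))) = true
chairAdj _ _ = false

-- Equality test on Fin 5 (to keep the complement loopless).
eqFin : ∀ {m} → Fin m → Fin m → Bool
eqFin zero zero = true
eqFin zero (suc _) = false
eqFin (suc _) zero = false
eqFin (suc i) (suc j) = eqFin i j

kiteAdj : Fin 5 → Fin 5 → Bool
kiteAdj i j = not (eqFin i j) ∧ not (chairAdj i j)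

HasInduced : ∀ {n} → Graph n → (Fin 5 → Fin 5 → Bool) → Set
HasInduced {n} G H =
  Σ (Fin 5 → Fin n) (λ f → Injective _≡_ _≡_ f × (∀ i j → adj G (f i) (f j) ≡ H i j))

{-# OPTIONS --safe #-}

-- Delete a vertex v and colour G - v with k colours, and suppose G is not k-colourable. Call a
-- neighbour of v lone if no other neighbour of v has its colour. As 2k ≥ Δ + ω + 1, there are
-- more than ω lone vertices, and since v together with ω of them is never a clique, the
-- non-edges between them cannot all be covered by one vertex. Forbidding the chair makes the
-- Kempe chain between two non-adjacent lone vertices x, y an induced path x, p, p′, …, y.
-- Local arguments at the first two steps of such chains show that the lone vertices contain
-- no independent triple and no induced P4; if they contain an induced C4, then both its chains
-- have four vertices and an explicit recolouring frees a colour. What remains are two disjoint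
-- edges xz and yw with nothing in between, as in the line graph of a triangle-free graph.
-- There, as in Shannon's bound on the chromatic index, x has a neighbour of every other lone
-- colour such that these neighbours and x form a clique, which has more than ω vertices.
module Submission where

open import Defs
open import Data.Bool using (Bool; true; false; if_then_else_)
open import Data.Bool.Properties using (¬-not) renaming (_≟_ to _≟ᵇ_)
open import Data.Empty using (⊥; ⊥-elim)
open import Data.Fin using (Fin; zero; suc; punchOut)
open import Data.Fin.Patterns using (0F; 1F; 2F; 3F; 4F)
open import Data.Fin.Permutation.Components using (transpose; transpose-inverse)
open import Data.Fin.Properties using (_≟_; any?; all?; punchOut-injective; suc-injective)
open import Data.Fin.Subset using (Subset; _-_; ∣_∣; ⊤) renaming (_∈_ to _∈ₛ_)
open import Data.Fin.Subset.Properties using (x∈p⇒∣p-x∣<∣p∣; x∈p∧x≢y⇒x∈p-y; ∣p∣≤n; ∈⊤)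
open import Data.List using (List; []; _∷_; _++_; length; map; filter; foldr; allFin)
open import Data.List.Membership.Propositional using (_∈_; _∉_)
open import Data.List.Membership.Propositional.Properties
  using (∈-allFin; ∈-filter⁻; ∈-map⁻; ∈-++⁻)
open import Data.List.Properties using (length-map; length-++; length-tabulate)
open import Data.List.Relation.Unary.All using ([]; _∷_; lookup) renaming (tabulate to All-tabulate)
open import Data.List.Relation.Unary.All.Properties using (¬Any⇒All¬) renaming (map⁺ to All-map⁺)
open import Data.List.Relation.Unary.AllPairs using ([]; _∷_)
open import Data.List.Relation.Unary.Any using (here; there)
open import Data.List.Relation.Unary.Unique.Propositional using (Unique)
open import Data.List.Relation.Unary.Unique.Propositional.Properties
  using (++⁺; allFin⁺; filter⁺; map⁺)
open import Data.Nat using (ℕ; zero; suc; _+_; _⊔_; _≤_; _<_; z≤n; s≤s; ⌈_/2⌉; ⌊_/2⌋)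
open import Data.Nat.Properties
  using (≤-trans; ≤-refl; ≤-reflexive; <⇒≱; n≤1+n; m≤m⊔n; m≤n⊔m; +-identityʳ; +-suc; +-comm; +-assoc;
         +-cancelˡ-≤; +-monoˡ-≤; ⌊n/2⌋+⌈n/2⌉≡n; ⌊n/2⌋≤⌈n/2⌉; module ≤-Reasoning)
open import Data.Product using (∃; _×_; _,_; proj₁; proj₂)
open import Data.Sum using (_⊎_; inj₁; inj₂)
open import Data.Vec using (tabulate; there) renaming (_∷_ to _∷ᵛ_)
open import Data.Vec.Functional using () renaming (_∷_ to _∷ᶠ_)
open import Data.Vec.Properties using (lookup∘tabulate; lookup⇒[]=; []=⇒lookup)
open import Function using (_∘_; case_of_; id)
open import Relation.Binary.PropositionalEquality
  using (_≡_; _≢_; refl; sym; trans; cong; cong₂; subst; ≢-sym)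
open import Relation.Nullary using (¬_; Dec; yes; no; does; contradiction)
open import Relation.Nullary.Decidable
  using (decidable-stable; _×-dec_; _⊎-dec_; _→-dec_; ¬?; dec-true; dec-false)
open import Relation.Unary using (Decidable)

-- Counting with duplicate-free lists.

module _ {n : ℕ} where
  open import Data.List.Membership.DecPropositional (_≟_ {n}) using (_∈?_) public

  length≤∣p∣ : ∀ {xs : List (Fin n)} (p : Subset n) → Unique xs → (∀ {x} → x ∈ xs → x ∈ₛ p) →
               length xs ≤ ∣ p ∣
  length≤∣p∣ {[]} p _ _ = z≤n
  length≤∣p∣ {x ∷ xs} p (x∉xs ∷ unique) sub =
    ≤-trans (s≤s (length≤∣p∣ (p - x) unique sub′)) (x∈p⇒∣p-x∣<∣p∣ (sub (here refl)))
    where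
    sub′ : ∀ {y} → y ∈ xs → y ∈ₛ p - x
    sub′ y∈xs = x∈p∧x≢y⇒x∈p-y (sub (there y∈xs)) (≢-sym (lookup x∉xs y∈xs))

  length≤n : ∀ {xs : List (Fin n)} → Unique xs → length xs ≤ n
  length≤n unique = ≤-trans (length≤∣p∣ ⊤ unique (λ _ → ∈⊤)) (∣p∣≤n {n} ⊤)

∈-tabulate-true : ∀ {n} (f : Fin n → Bool) {i} → f i ≡ true → i ∈ₛ tabulate f
∈-tabulate-true f {i} eq = lookup⇒[]= i (tabulate f) (trans (lookup∘tabulate f i) eq)

-- Injectivity is asked on the list only, because the maps in question take junk values elsewhere.
unique-map : ∀ {A B : Set} (f : A → B) {xs} → (∀ {i j} → i ∈ xs → j ∈ xs → i ≢ j → f i ≢ f j) →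
             Unique xs → Unique (map f xs)
unique-map f {[]} _ _ = []
unique-map f {x ∷ xs} inj (x∉xs ∷ unique) =
  All-map⁺ (All-tabulate λ j∈ → inj (here refl) (there j∈) (lookup x∉xs j∈)) ∷
  unique-map f (λ i∈ j∈ → inj (there i∈) (there j∈)) unique

length-filter-split : ∀ {A : Set} {P : A → Set} (P? : Decidable P) xs →
                      length (filter P? xs) + length (filter (¬? ∘ P?) xs) ≡ length xs
length-filter-split P? [] = refl
length-filter-split P? (x ∷ xs) with P? x
... | yes _ = cong suc (length-filter-split P? xs)
... | no _  = trans (+-suc (length (filter P? xs)) _) (cong suc (length-filter-split P? xs))

-- Adjacency and the two forbidden subgraphs.

module Adjacency {m} (G : Graph m) where

  infix 4 _~_ _≁_

  _~_ _≁_ : Fin m → Fin m → Set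
  a ~ b = adj G a b ≡ true
  a ≁ b = adj G a b ≡ false

  ~-sym : ∀ {a b} → a ~ b → b ~ a
  ~-sym {a} {b} = trans (adj-sym G b a)

  ≁-sym : ∀ {a b} → a ≁ b → b ≁ a
  ≁-sym {a} {b} = trans (adj-sym G b a)

  ~⇒¬≁ : ∀ {a b} → a ~ b → a ≁ b → ⊥
  ~⇒¬≁ p q = case trans (sym p) q of λ ()

  ¬~⇒≁ : ∀ {a b} → ¬ a ~ b → a ≁ b
  ¬~⇒≁ = ¬-not

  ¬≁⇒~ : ∀ {a b} → ¬ a ≁ b → a ~ b
  ¬≁⇒~ = ¬-not

  _~?_ : ∀ a b → Dec (a ~ b)
  a ~? b = adj G a b ≟ᵇ true

  ~-or-≁ : ∀ a b → a ~ b ⊎ a ≁ b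
  ~-or-≁ a b with a ~? b
  ... | yes p = inj₁ p
  ... | no p  = inj₂ (¬~⇒≁ p)

  ~⇒≢ : ∀ {a b} → a ~ b → a ≢ b
  ~⇒≢ p refl = ~⇒¬≁ p (adj-irrefl G _)

  separated : ∀ {a b w} → a ~ w → b ≁ w → a ≢ b
  separated p q refl = ~⇒¬≁ p q

  module Forbidden (no-chair : ¬ HasInduced G chairAdj) (no-kite : ¬ HasInduced G kiteAdj) where

    -- The two leaves a and c are twins, so their distinctness is not
    -- implied by the adjacencies; all other distinctness is.
    chair : ∀ {a b c d e} → a ~ b → b ~ c → b ~ d → d ~ e →
            a ≁ c → a ≁ d → a ≁ e → b ≁ e → c ≁ d → c ≁ e → a ≢ c → ⊥
    chair {a} {b} {c} {d} {e} ab bc bd de ac ad ae be cd ce a≢c = no-chair (f , f-inj , f-adj)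
      where
      f : Fin 5 → Fin m
      f 0F = a
      f 1F = b
      f 2F = c
      f 3F = d
      f 4F = e
      f-adj : ∀ i j → adj G (f i) (f j) ≡ chairAdj i j
      f-adj 0F 0F = adj-irrefl G _
      f-adj 0F 1F = ab
      f-adj 0F 2F = ac
      f-adj 0F 3F = ad
      f-adj 0F 4F = ae
      f-adj 1F 0F = ~-sym ab
      f-adj 1F 1F = adj-irrefl G _
      f-adj 1F 2F = bc
      f-adj 1F 3F = bd
      f-adj 1F 4F = be
      f-adj 2F 0F = ≁-sym ac
      f-adj 2F 1F = ~-sym bc
      f-adj 2F 2F = adj-irrefl G _
      f-adj 2F 3F = cd
      f-adj 2F 4F = ce
      f-adj 3F 0F = ≁-sym ad
      f-adj 3F 1F = ~-sym bd
      f-adj 3F 2F = ≁-sym cd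
      f-adj 3F 3F = adj-irrefl G _
      f-adj 3F 4F = de
      f-adj 4F 0F = ≁-sym ae
      f-adj 4F 1F = ≁-sym be
      f-adj 4F 2F = ≁-sym ce
      f-adj 4F 3F = ~-sym de
      f-adj 4F 4F = adj-irrefl G _
      f-inj : ∀ {i j} → f i ≡ f j → i ≡ j
      f-inj {0F} {0F} _ = refl
      f-inj {0F} {1F} p = contradiction p (~⇒≢ ab)
      f-inj {0F} {2F} p = contradiction p a≢c
      f-inj {0F} {3F} p = contradiction (sym p) (separated de ae)
      f-inj {0F} {4F} p = contradiction p (separated ab (≁-sym be))
      f-inj {1F} {0F} p = contradiction (sym p) (~⇒≢ ab)
      f-inj {1F} {1F} _ = refl
      f-inj {1F} {2F} p = contradiction p (~⇒≢ bc)
      f-inj {1F} {3F} p = contradiction p (~⇒≢ bd)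
      f-inj {1F} {4F} p = contradiction p (separated bc (≁-sym ce))
      f-inj {2F} {0F} p = contradiction (sym p) a≢c
      f-inj {2F} {1F} p = contradiction (sym p) (~⇒≢ bc)
      f-inj {2F} {2F} _ = refl
      f-inj {2F} {3F} p = contradiction (sym p) (separated de ce)
      f-inj {2F} {4F} p = contradiction p (separated (~-sym bc) (≁-sym be))
      f-inj {3F} {0F} p = contradiction p (separated de ae)
      f-inj {3F} {1F} p = contradiction (sym p) (~⇒≢ bd)
      f-inj {3F} {2F} p = contradiction p (separated de ce)
      f-inj {3F} {3F} _ = refl
      f-inj {3F} {4F} p = contradiction p (~⇒≢ de)
      f-inj {4F} {0F} p = contradiction (sym p) (separated ab (≁-sym be))
      f-inj {4F} {1F} p = contradiction (sym p) (separated bc (≁-sym ce))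
      f-inj {4F} {2F} p = contradiction (sym p) (separated (~-sym bc) (≁-sym be))
      f-inj {4F} {3F} p = contradiction (sym p) (~⇒≢ de)
      f-inj {4F} {4F} _ = refl

    -- The diamond has spine `a c` and tips `d`, `e`, and `b` hangs at `e`. Here the adjacencies
    -- alone make all five vertices distinct.
    kite : ∀ {a b c d e} → a ~ c → a ~ d → a ~ e → b ~ e → c ~ d → c ~ e →
           a ≁ b → b ≁ c → b ≁ d → d ≁ e → ⊥
    kite {a} {b} {c} {d} {e} ac ad ae be cd ce ab bc bd de = no-kite (f , f-inj , f-adj)
      where
      f : Fin 5 → Fin m
      f 0F = a
      f 1F = b
      f 2F = c
      f 3F = d
      f 4F = e
      f-adj : ∀ i j → adj G (f i) (f j) ≡ kiteAdj i j
      f-adj 0F 0F = adj-irrefl G _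
      f-adj 0F 1F = ab
      f-adj 0F 2F = ac
      f-adj 0F 3F = ad
      f-adj 0F 4F = ae
      f-adj 1F 0F = ≁-sym ab
      f-adj 1F 1F = adj-irrefl G _
      f-adj 1F 2F = bc
      f-adj 1F 3F = bd
      f-adj 1F 4F = be
      f-adj 2F 0F = ~-sym ac
      f-adj 2F 1F = ≁-sym bc
      f-adj 2F 2F = adj-irrefl G _
      f-adj 2F 3F = cd
      f-adj 2F 4F = ce
      f-adj 3F 0F = ~-sym ad
      f-adj 3F 1F = ≁-sym bd
      f-adj 3F 2F = ~-sym cd
      f-adj 3F 3F = adj-irrefl G _
      f-adj 3F 4F = de
      f-adj 4F 0F = ~-sym ae
      f-adj 4F 1F = ~-sym be
      f-adj 4F 2F = ~-sym ce
      f-adj 4F 3F = ≁-sym de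
      f-adj 4F 4F = adj-irrefl G _
      f-inj : ∀ {i j} → f i ≡ f j → i ≡ j
      f-inj {0F} {0F} _ = refl
      f-inj {0F} {1F} p = contradiction p (separated ac bc)
      f-inj {0F} {2F} p = contradiction p (~⇒≢ ac)
      f-inj {0F} {3F} p = contradiction p (~⇒≢ ad)
      f-inj {0F} {4F} p = contradiction p (~⇒≢ ae)
      f-inj {1F} {0F} p = contradiction (sym p) (separated ac bc)
      f-inj {1F} {1F} _ = refl
      f-inj {1F} {2F} p = contradiction (sym p) (separated (~-sym ac) (≁-sym ab))
      f-inj {1F} {3F} p = contradiction p (separated be de)
      f-inj {1F} {4F} p = contradiction p (~⇒≢ be)
      f-inj {2F} {0F} p = contradiction (sym p) (~⇒≢ ac)
      f-inj {2F} {1F} p = contradiction p (separated (~-sym ac) (≁-sym ab))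
      f-inj {2F} {2F} _ = refl
      f-inj {2F} {3F} p = contradiction p (~⇒≢ cd)
      f-inj {2F} {4F} p = contradiction p (~⇒≢ ce)
      f-inj {3F} {0F} p = contradiction (sym p) (~⇒≢ ad)
      f-inj {3F} {1F} p = contradiction (sym p) (separated be de)
      f-inj {3F} {2F} p = contradiction (sym p) (~⇒≢ cd)
      f-inj {3F} {3F} _ = refl
      f-inj {3F} {4F} p = contradiction (sym p) (separated (~-sym be) (≁-sym bd))
      f-inj {4F} {0F} p = contradiction (sym p) (~⇒≢ ae)
      f-inj {4F} {1F} p = contradiction (sym p) (~⇒≢ be)
      f-inj {4F} {2F} p = contradiction (sym p) (~⇒≢ ce)
      f-inj {4F} {3F} p = contradiction p (separated (~-sym be) (≁-sym bd))
      f-inj {4F} {4F} _ = refl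

-- Transposing two colours.

module Transposition {n : ℕ} where

  transpose-left : ∀ (β γ : Fin n) → transpose β γ β ≡ γ
  transpose-left β γ rewrite dec-true (β ≟ β) refl = refl

  transpose-right : ∀ (β γ : Fin n) → transpose β γ γ ≡ β
  transpose-right β γ with γ ≟ β
  ... | yes γ≡β = γ≡β
  ... | no _ rewrite dec-true (γ ≟ γ) refl = refl

  transpose-other : ∀ {β γ κ : Fin n} → κ ≢ β → κ ≢ γ → transpose β γ κ ≡ κ
  transpose-other {β} {γ} {κ} p q rewrite dec-false (κ ≟ β) p | dec-false (κ ≟ γ) q = refl

  transpose-cases : ∀ (β γ κ : Fin n) →
    (κ ≡ β × transpose β γ κ ≡ γ) ⊎ (κ ≡ γ × transpose β γ κ ≡ β) ⊎
    (κ ≢ β × κ ≢ γ × transpose β γ κ ≡ κ)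
  transpose-cases β γ κ with κ ≟ β
  ... | yes refl = inj₁ (refl , refl)
  ... | no κ≢β with κ ≟ γ
  ...   | yes refl = inj₂ (inj₁ (refl , refl))
  ...   | no κ≢γ   = inj₂ (inj₂ (κ≢β , κ≢γ , refl))

  transpose-injective : ∀ (β γ : Fin n) {κ μ} → transpose β γ κ ≡ transpose β γ μ → κ ≡ μ
  transpose-injective β γ {κ} {μ} eq =
    trans (sym (transpose-inverse γ β)) (trans (cong (transpose γ β) eq) (transpose-inverse γ β))

-- Colourings of G - v that do not extend to v, recolouring and Kempe swaps.

open Transposition

-- Throughout, a k-colouring of G - v is presented as a proper (k+1)-colouring
-- of G whose colour zero is used on v only; G itself is not k-colourable.
module Stuck {m k} (G : Graph m) (uncolourable : ¬ Colourable G k) (v : Fin m) where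

  open Adjacency G

  Colouring : Set
  Colouring = Fin m → Fin (suc k)

  -- If a colour were missing, `punchOut` would rename the others into a colouring with `k` colours.
  every-colour-used : ∀ {c : Colouring} → IsProperColouring G c → ∀ κ → ∃ λ a → c a ≡ κ
  every-colour-used {c} proper κ with any? (λ a → c a ≟ κ)
  ... | yes p = p
  ... | no p  = ⊥-elim (uncolourable ((λ a → punchOut (avoids a)) ,
        λ a b a~b eq → proper a b a~b (punchOut-injective (avoids a) (avoids b) eq)))
    where
    avoids : ∀ a → κ ≢ c a
    avoids a eq = p (a , sym eq)

  opaque
    recolour : Colouring → Fin m → Fin (suc k) → Colouring
    recolour c a κ b = if does (b ≟ a) then κ else c b

    recolour-cases : ∀ c a κ b →
      (b ≡ a × recolour c a κ b ≡ κ) ⊎ (b ≢ a × recolour c a κ b ≡ c b)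
    recolour-cases c a κ b with b ≟ a
    ... | yes p = inj₁ (p , refl)
    ... | no p  = inj₂ (p , refl)

  recolour-inv : ∀ {c a κ b μ} → recolour c a κ b ≡ μ → (b ≡ a × κ ≡ μ) ⊎ (b ≢ a × c b ≡ μ)
  recolour-inv {c} {a} {κ} {b} eq with recolour-cases c a κ b
  ... | inj₁ (p , q) = inj₁ (p , trans (sym q) eq)
  ... | inj₂ (p , q) = inj₂ (p , trans (sym q) eq)

  recolour-keep : ∀ {c a κ b μ} → κ ≢ μ → recolour c a κ b ≡ μ → b ≢ a × c b ≡ μ
  recolour-keep {c} {a} {κ} {b} κ≢μ eq with recolour-inv {c} {a} {κ} {b} eq
  ... | inj₁ (_ , κ≡μ) = contradiction κ≡μ κ≢μ
  ... | inj₂ kept      = kept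

  recolour-proper : ∀ {c a κ} → IsProperColouring G c → (∀ {b} → a ~ b → c b ≢ κ) →
                    IsProperColouring G (recolour c a κ)
  recolour-proper {c} {a} {κ} proper free b d b~d eq
    with recolour-cases c a κ b | recolour-cases c a κ d
  ... | inj₁ (refl , _) | inj₁ (refl , _) = ~⇒≢ b~d refl
  ... | inj₁ (refl , p) | inj₂ (_ , q)    = free b~d (trans (sym q) (trans (sym eq) p))
  ... | inj₂ (_ , p)    | inj₁ (refl , q) = free (~-sym b~d) (trans (sym p) (trans eq q))
  ... | inj₂ (_ , p)    | inj₂ (_ , q)    = proper b d b~d (trans (sym p) (trans eq q))

  record Solo (c : Colouring) : Set where
    field
      proper : IsProperColouring G c
      at-v   : c v ≡ zero
      only-v : ∀ {a} → c a ≡ zero → a ≡ v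
  open Solo

  Lone : Colouring → Fin m → Set
  Lone c x = v ~ x × (∀ {a} → v ~ a → c a ≡ c x → a ≡ x)

  lone-≢0 : ∀ {c x} → Solo c → Lone c x → c x ≢ zero
  lone-≢0 s (v~x , _) eq = ~⇒≢ v~x (sym (only-v s eq))

  every-colour-seen : ∀ {c} → Solo c → ∀ κ → κ ≢ zero → ∃ λ a → v ~ a × c a ≡ κ
  every-colour-seen {c} s κ κ≢0 with any? (λ a → (v ~? a) ×-dec (c a ≟ κ))
  ... | yes p = p
  ... | no p with every-colour-used (recolour-proper (proper s) (λ v~b eq → p (_ , v~b , eq))) zero
  ...   | a , eq with recolour-inv {c} {v} {κ} {a} eq
  ...     | inj₁ (_ , κ≡0)     = contradiction κ≡0 κ≢0
  ...     | inj₂ (a≢v , ca≡0) = contradiction (only-v s ca≡0) a≢v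

  -- Otherwise move x to colour κ, which frees the old colour of x for v.
  lone-sees-colour : ∀ {c x} → Solo c → Lone c x → ∀ κ → κ ≢ zero → κ ≢ c x →
                     ∃ λ p → x ~ p × c p ≡ κ
  lone-sees-colour {c} {x} s lone@(v~x , only) κ κ≢0 κ≢cx with any? (λ a → (x ~? a) ×-dec (c a ≟ κ))
  ... | yes p = p
  ... | no p with every-colour-seen moved (c x) (lone-≢0 s lone)
    where
    moved : Solo (recolour c x κ)
    moved .proper = recolour-proper (proper s) (λ x~b eq → p (_ , x~b , eq))
    moved .at-v with recolour-cases c x κ v
    ... | inj₁ (v≡x , _) = contradiction v≡x (~⇒≢ v~x)
    ... | inj₂ (_ , q)   = trans q (at-v s)
    moved .only-v {a} eq with recolour-inv {c} {x} {κ} {a} eq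
    ... | inj₁ (_ , κ≡0) = contradiction κ≡0 κ≢0
    ... | inj₂ (_ , q)   = only-v s q
  ...   | a , v~a , eq with recolour-inv {c} {x} {κ} {a} eq
  ...     | inj₁ (_ , κ≡cx)     = contradiction κ≡cx κ≢cx
  ...     | inj₂ (a≢x , ca≡cx) = contradiction (only v~a ca≡cx) a≢x

  OneOf : Fin (suc k) → Fin (suc k) → Fin (suc k) → Set
  OneOf β γ κ = κ ≡ β ⊎ κ ≡ γ

  -- Among the vertices coloured `β` or `γ`, `P` is a union of components. Vertices of other colours
  -- may lie in `P` or not, since the swap fixes their colours.
  KempeClosed : Colouring → Fin (suc k) → Fin (suc k) → (Fin m → Set) → Set
  KempeClosed c β γ P = ∀ {a b} → P a → a ~ b → OneOf β γ (c a) → OneOf β γ (c b) → P b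

  KempeClosed-∁ : ∀ {c β γ P} → KempeClosed c β γ P → KempeClosed c β γ (¬_ ∘ P)
  KempeClosed-∁ closed ¬Pa a~b ka kb Pb = ¬Pa (closed Pb (~-sym a~b) kb ka)

  kempe-swap : ∀ {P : Fin m → Set} → Decidable P → Fin (suc k) → Fin (suc k) → Colouring → Colouring
  kempe-swap P? β γ c a = if does (P? a) then transpose β γ (c a) else c a

  module _ {P : Fin m → Set} (P? : Decidable P) (β γ : Fin (suc k)) (c : Colouring) where

    kempe-swap-cases : ∀ a → (P a × kempe-swap P? β γ c a ≡ transpose β γ (c a)) ⊎
                             (¬ P a × kempe-swap P? β γ c a ≡ c a)
    kempe-swap-cases a with P? a
    ... | yes p = inj₁ (p , refl)
    ... | no p  = inj₂ (p , refl)

    kempe-swap-other : ∀ {a μ} → μ ≢ β → μ ≢ γ → kempe-swap P? β γ c a ≡ μ → c a ≡ μ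
    kempe-swap-other {a} μ≢β μ≢γ eq with kempe-swap-cases a
    ... | inj₂ (_ , q) = trans (sym q) eq
    ... | inj₁ (_ , q) with transpose-cases β γ (c a)
    ...   | inj₁ (_ , r)              = contradiction (trans (sym eq) (trans q r)) μ≢γ
    ...   | inj₂ (inj₁ (_ , r))       = contradiction (trans (sym eq) (trans q r)) μ≢β
    ...   | inj₂ (inj₂ (_ , _ , r))   = trans (sym r) (trans (sym q) eq)

    kempe-swap-solo : Solo c → β ≢ zero → γ ≢ zero → KempeClosed c β γ P → Solo (kempe-swap P? β γ c)
    kempe-swap-solo s β≢0 γ≢0 closed = record { proper = proper′ ; at-v = at-v′ ; only-v = only-v′ }
      where
      across : ∀ {a b} → P a → ¬ P b → a ~ b → transpose β γ (c a) ≢ c b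
      across {a} {b} Pa ¬Pb a~b eq with transpose-cases β γ (c a)
      ... | inj₁ (p , r)            = ¬Pb (closed Pa a~b (inj₁ p) (inj₂ (trans (sym eq) r)))
      ... | inj₂ (inj₁ (p , r))     = ¬Pb (closed Pa a~b (inj₂ p) (inj₁ (trans (sym eq) r)))
      ... | inj₂ (inj₂ (_ , _ , r)) = proper s a b a~b (trans (sym r) eq)
      proper′ : IsProperColouring G (kempe-swap P? β γ c)
      proper′ a b a~b eq with kempe-swap-cases a | kempe-swap-cases b
      ... | inj₁ (_ , p)  | inj₁ (_ , q)   =
        proper s a b a~b (transpose-injective β γ (trans (sym p) (trans eq q)))
      ... | inj₁ (Pa , p) | inj₂ (¬Pb , q) = across Pa ¬Pb a~b (trans (sym p) (trans eq q))
      ... | inj₂ (¬Pa , p) | inj₁ (Pb , q) = across Pb ¬Pa (~-sym a~b) (trans (sym q) (trans (sym eq) p))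
      ... | inj₂ (_ , p)  | inj₂ (_ , q)   = proper s a b a~b (trans (sym p) (trans eq q))
      at-v′ : kempe-swap P? β γ c v ≡ zero
      at-v′ with kempe-swap-cases v
      ... | inj₂ (_ , q) = trans q (at-v s)
      ... | inj₁ (_ , q) = trans q (trans (cong (transpose β γ) (at-v s))
                                          (transpose-other (≢-sym β≢0) (≢-sym γ≢0)))
      only-v′ : ∀ {a} → kempe-swap P? β γ c a ≡ zero → a ≡ v
      only-v′ eq = only-v s (kempe-swap-other (≢-sym β≢0) (≢-sym γ≢0) eq)

  -- Otherwise swapping the colours on P frees the colour of x for v.
  kempe-linked : ∀ {c x y} {P : Fin m → Set} → Solo c → Lone c x → Lone c y → Decidable P →
                 KempeClosed c (c x) (c y) P → P x → ¬ ¬ P y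
  kempe-linked {c} {x} {y} {P} s lx@(_ , only-x) ly@(_ , only-y) P? closed Px ¬Py
    with every-colour-seen (kempe-swap-solo P? (c x) (c y) c s (lone-≢0 s lx) (lone-≢0 s ly) closed)
                           (c x) (lone-≢0 s lx)
  ... | a , v~a , eq with kempe-swap-cases P? (c x) (c y) c a
  ...   | inj₂ (¬Pa , q) = ¬Pa (subst P (sym (only-x v~a (trans (sym q) eq))) Px)
  ...   | inj₁ (Pa , q) = ¬Py (subst P (only-y v~a ca≡cy) Pa)
    where
    ca≡cy : c a ≡ c y
    ca≡cy = transpose-injective (c x) (c y)
              (trans (trans (sym q) eq) (sym (transpose-right (c x) (c y))))

-- Lone vertices and the first steps of their Kempe chains.

module Local {m k} (G : Graph m)
             (no-chair : ¬ HasInduced G chairAdj) (no-kite : ¬ HasInduced G kiteAdj)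
             (uncolourable : ¬ Colourable G k) (v : Fin m)
             (c : Fin m → Fin (suc k)) (solo : Stuck.Solo G uncolourable v c) where

  open Adjacency G
  open Forbidden no-chair no-kite
  open Stuck G uncolourable v
  open Solo solo

  same-colour-≁ : ∀ {a b} → c a ≡ c b → a ≁ b
  same-colour-≁ eq = ¬~⇒≁ (λ a~b → proper _ _ a~b eq)

  colours-≢ : ∀ {a b} → c a ≢ c b → a ≢ b
  colours-≢ ca≢cb refl = ca≢cb refl

  lone-colours-≢ : ∀ {x y} → Lone c x → Lone c y → x ≢ y → c x ≢ c y
  lone-colours-≢ (v~x , _) (_ , only-y) x≢y eq = x≢y (only-y v~x eq)

  lone-≁ : ∀ {x b} → Lone c x → c b ≡ c x → b ≢ x → v ≁ b
  lone-≁ (_ , only) eq b≢x = ¬~⇒≁ (λ v~b → b≢x (only v~b eq))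

  -- The first two steps x, p, p′ of the Kempe chain from x to y.
  record Mate (x y : Fin m) : Set where
    field
      p p′  : Fin m
      x~p   : x ~ p
      cp    : c p ≡ c y
      only  : ∀ {b} → x ~ b → c b ≡ c y → b ≡ p
      p~p′  : p ~ p′
      cp′   : c p′ ≡ c x
      v≁p   : v ≁ p
      y≁p   : y ≁ p
      v≁p′  : v ≁ p′
      x≁p′  : x ≁ p′

  opaque
    -- A second neighbour of `x` in the colour of `y` would give a chair with centre `x`, these two
    -- neighbours as leaves and path `x`, `v`, `y`. If `p` had no neighbour but `x` in the colour of
    -- `x`, the set of `x` and `p` would be Kempe closed and miss `y`, against `kempe-linked`.
    mate : ∀ {x y} → Lone c x → Lone c y → x ≢ y → x ≁ y → Mate x y
    mate {x} {y} lx@(v~x , only-x) ly@(v~y , only-y) x≢y x≁y =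
      record { p = p ; p′ = p′ ; x~p = x~p ; cp = cp ; only = only ; p~p′ = p~p′ ; cp′ = cp′
             ; v≁p = v≁p ; y≁p = same-colour-≁ (sym cp)
             ; v≁p′ = lone-≁ lx cp′ p′≢x ; x≁p′ = same-colour-≁ (sym cp′) }
      where
      cx≢cy : c x ≢ c y
      cx≢cy = lone-colours-≢ lx ly x≢y
      first : ∃ λ p → x ~ p × c p ≡ c y
      first = lone-sees-colour solo lx (c y) (lone-≢0 solo ly) (≢-sym cx≢cy)
      p : Fin m
      p = proj₁ first
      x~p : x ~ p
      x~p = proj₁ (proj₂ first)
      cp : c p ≡ c y
      cp = proj₂ (proj₂ first)
      nbr-≁v : ∀ {b} → x ~ b → c b ≡ c y → v ≁ b
      nbr-≁v x~b cb = lone-≁ ly cb (separated (~-sym x~b) (≁-sym x≁y))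
      v≁p : v ≁ p
      v≁p = nbr-≁v x~p cp
      only : ∀ {b} → x ~ b → c b ≡ c y → b ≡ p
      only {b} x~b cb = decidable-stable (b ≟ p) λ b≢p →
        let b≁p = same-colour-≁ (trans cb (sym cp))
            v≁b = nbr-≁v x~b cb
            b≁y = same-colour-≁ cb
            p≁y = same-colour-≁ cp
        in chair (~-sym x~b) x~p (~-sym v~x) v~y b≁p (≁-sym v≁b) b≁y x≁y (≁-sym v≁p) p≁y b≢p
      Second : Fin m → Set
      Second b = p ~ b × c b ≡ c x × b ≢ x
      second : Dec (∃ Second)
      second = any? (λ b → (p ~? b) ×-dec (c b ≟ c x) ×-dec ¬? (b ≟ x))
      In : Fin m → Set
      In b = b ≡ x ⊎ b ≡ p
      has-second : ∃ Second
      has-second = decidable-stable second λ none →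
        let closed : KempeClosed c (c x) (c y) In
            closed = λ
              { (inj₁ refl) x~b _ (inj₁ cb≡cx) → contradiction (sym cb≡cx) (proper _ _ x~b)
              ; (inj₁ refl) x~b _ (inj₂ cb≡cy) → inj₂ (only x~b cb≡cy)
              ; (inj₂ refl) p~b _ (inj₁ cb≡cx) →
                  inj₁ (decidable-stable (_ ≟ x) (λ b≢x → none (_ , p~b , cb≡cx , b≢x)))
              ; (inj₂ refl) p~b _ (inj₂ cb≡cy) → contradiction (trans cp (sym cb≡cy)) (proper _ _ p~b) }
        in kempe-linked solo lx ly (λ b → (b ≟ x) ⊎-dec (b ≟ p)) closed (inj₁ refl) λ
             { (inj₁ y≡x) → x≢y (sym y≡x)
             ; (inj₂ y≡p) → ~⇒¬≁ (subst (x ~_) (sym y≡p) x~p) x≁y }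
      p′ : Fin m
      p′ = proj₁ has-second
      p~p′ : p ~ p′
      p~p′ = proj₁ (proj₂ has-second)
      cp′ : c p′ ≡ c x
      cp′ = proj₁ (proj₂ (proj₂ has-second))
      p′≢x : p′ ≢ x
      p′≢x = proj₂ (proj₂ (proj₂ has-second))

  -- Independent triples and induced P4s among the lone vertices.

  -- With `mate-~`, this says that a common neighbour `z` of `v` and `x` sees `p` exactly if it sees
  -- `y`. If `z ≁ y`, an edge `z p` makes a diamond with tips `p`, `v` and `y` hanging at `v`; if
  -- `z ~ y`, a missing one makes `p` hang at `x` on the diamond with tips `x`, `y`.
  mate-≁ : ∀ {x y z p} → v ~ x → v ~ y → v ~ z → x ~ p → v ≁ p → y ≁ p →
           x ≁ y → z ~ x → z ≁ y → z ≁ p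
  mate-≁ {x} {y} {z} {p} v~x v~y v~z x~p v≁p y≁p x≁y z~x z≁y =
    ¬~⇒≁ λ z~p → kite z~x z~p (~-sym v~z) (~-sym v~y) x~p (~-sym v~x) z≁y (≁-sym x≁y) y≁p
                   (≁-sym v≁p)

  mate-~ : ∀ {x y z p} → v ~ x → v ~ y → v ~ z → x ~ p → v ≁ p → y ≁ p →
           x ≁ y → z ~ x → z ~ y → z ~ p
  mate-~ {x} {y} {z} {p} v~x v~y v~z x~p v≁p y≁p x≁y z~x z~y =
    ¬≁⇒~ λ z≁p → kite v~z v~y v~x (~-sym x~p) z~y z~x v≁p (≁-sym z≁p) (≁-sym y≁p) (≁-sym x≁y)

  -- Otherwise `p′` hangs at `p` on the diamond with spine `x z` and tips `v`, `p`.
  second-~ : ∀ {x z p p′} → v ~ x → v ~ z → x ~ p → v ≁ p → p ~ p′ → v ≁ p′ → x ≁ p′ →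
             z ~ x → z ~ p → z ~ p′
  second-~ {x} {z} {p} {p′} v~x v~z x~p v≁p p~p′ v≁p′ x≁p′ z~x z~p =
    ¬≁⇒~ λ z≁p′ → kite (~-sym z~x) (~-sym v~x) x~p (~-sym p~p′) (~-sym v~z) z~p x≁p′
                    (≁-sym z≁p′) (≁-sym v≁p′) v≁p

  -- With x, y, z independent, the mate of x towards y is also the mate of z towards y.
  shared-mate : ∀ {x y z p} → v ~ x → v ~ y → v ~ z → x ~ p → v ≁ p → y ≁ p →
                x ≁ y → x ≁ z → y ≁ z → y ≢ z → z ~ p
  shared-mate {x} {y} {z} {p} v~x v~y v~z x~p v≁p y≁p x≁y x≁z y≁z y≢z =
    ¬≁⇒~ λ z≁p → chair (~-sym v~y) v~z v~x x~p y≁z (≁-sym x≁y) y≁p v≁p (≁-sym x≁z) z≁p y≢z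

  -- The vertex `z` sees both mates `a` and `b`. If `b ≁ a`, then `d` is not `a`, the only neighbour
  -- of `z` in the colour of `x`, so `z ≁ d`; hence `z` is the centre of a chair with leaves `v`,
  -- `a` and path `z`, `b`, `d`.
  mates-~ : ∀ {x y z} (lx : Lone c x) (ly : Lone c y) (lz : Lone c z) →
            x ≢ y → x ≢ z → y ≢ z → x ≁ y → x ≁ z → y ≁ z →
            (xy : Mate x y) (yx : Mate y x) → Mate.p xy ~ Mate.p yx
  mates-~ {x} {y} {z} lx@(v~x , _) ly@(v~y , _) lz@(v~z , _) x≢y x≢z y≢z x≁y x≁z y≁z xy yx =
    ¬≁⇒~ λ b≁a →
      let z~b = shared-mate v~x v~y v~z x~b v≁b y≁b x≁y x≁z y≁z y≢z
          z~a = shared-mate v~y v~x v~z y~a v≁a x≁a (≁-sym x≁y) y≁z x≁z x≢z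
          a≁d = same-colour-≁ (trans ca (sym cd))
          z≁d = ¬~⇒≁ λ z~d →
            ~⇒¬≁ b~d (subst (b ≁_) (trans (only z~a ca) (sym (only z~d cd))) b≁a)
      in chair v~z z~a z~b b~d v≁a v≁b v≁d z≁d (≁-sym b≁a) a≁d (separated v~x (≁-sym x≁a))
    where
    open Mate xy using () renaming
      (p to b; p′ to d; x~p to x~b; v≁p to v≁b; y≁p to y≁b; p~p′ to b~d; cp′ to cd; v≁p′ to v≁d)
    open Mate yx using () renaming (p to a; x~p to y~a; v≁p to v≁a; y≁p to x≁a; cp to ca)
    open Mate (mate lz lx (≢-sym x≢z) (≁-sym x≁z)) using (only)

  -- The mates `a`, `b`, `d`, one in each of the three colours, form a triangle. As `z` sees `a` and
  -- `b` but not `d`, which has its colour, `v` hangs at `z` on the diamond with tips `d`, `z`.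
  no-lone-triple : ∀ {x y z} → Lone c x → Lone c y → Lone c z →
                   x ≢ y → x ≢ z → y ≢ z → x ≁ y → x ≁ z → y ≁ z → ⊥
  no-lone-triple {x} {y} {z} lx@(v~x , _) ly@(v~y , _) lz@(v~z , _) x≢y x≢z y≢z x≁y x≁z y≁z =
    kite a~b a~d (~-sym z~a) v~z b~d (~-sym z~b) (≁-sym v≁a) v≁b v≁d (≁-sym z≁d)
    where
    xy = mate lx ly x≢y x≁y
    yx = mate ly lx (≢-sym x≢y) (≁-sym x≁y)
    xz = mate lx lz x≢z x≁z
    zx = mate lz lx (≢-sym x≢z) (≁-sym x≁z)
    yz = mate ly lz y≢z y≁z
    zy = mate lz ly (≢-sym y≢z) (≁-sym y≁z)
    open Mate xy using () renaming (p to b; x~p to x~b; v≁p to v≁b; y≁p to y≁b; cp to cb)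
    open Mate yx using () renaming (p to a; x~p to y~a; v≁p to v≁a; y≁p to x≁a; cp to ca)
    open Mate xz using () renaming (p to d; x~p to x~d; v≁p to v≁d; y≁p to z≁d; cp to cd)
    z~b : z ~ b
    z~b = shared-mate v~x v~y v~z x~b v≁b y≁b x≁y x≁z y≁z y≢z
    z~a : z ~ a
    z~a = shared-mate v~y v~x v~z y~a v≁a x≁a (≁-sym x≁y) y≁z x≁z x≢z
    y~d : y ~ d
    y~d = shared-mate v~x v~z v~y x~d v≁d z≁d x≁z x≁y (≁-sym y≁z) (≢-sym y≢z)
    a~b : a ~ b
    a~b = ~-sym (mates-~ lx ly lz x≢y x≢z y≢z x≁y x≁z y≁z xy yx)
    a~d : a ~ d
    a~d = subst (_~ d) (sym (Mate.only zx z~a ca))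
            (~-sym (mates-~ lx lz ly x≢z x≢y (≢-sym y≢z) x≁z x≁y (≁-sym y≁z) xz zx))
    b~d : b ~ d
    b~d = ~-sym (subst (_~ b) (sym (Mate.only yz y~d cd))
            (subst (Mate.p yz ~_) (sym (Mate.only zy z~b cb))
              (mates-~ ly lz lx y≢z (≢-sym x≢y) (≢-sym x≢z) y≁z (≁-sym x≁y) (≁-sym x≁z) yz zy)))

  -- Here `p` starts the chain from `x` to `y`, and `t`, `t′` the chain from `z` to `w`. Both `x`
  -- and `z` see `p` and `t`. It turns out that `t′` is seen by `x` but not by `p` or `y`, so `x` is
  -- the centre of a chair with leaves `p`, `t′` and path `x`, `v`, `y`.
  no-lone-P4 : ∀ {w x z y} → Lone c w → Lone c x → Lone c z → Lone c y →
               w ~ x → x ~ z → z ~ y → w ≁ z → w ≁ y → x ≁ y → ⊥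
  no-lone-P4 {w} {x} {z} {y} lw@(v~w , _) lx@(v~x , _) lz@(v~z , _) ly@(v~y , _)
             w~x x~z z~y w≁z w≁y x≁y =
    chair (~-sym x~p) x~t′ (~-sym v~x) v~y p≁t′ (≁-sym v≁p) (≁-sym y≁p) x≁y (≁-sym v≁t′)
      (≁-sym y≁t′) (separated (~-sym z~p) (≁-sym z≁t′))
    where
    x≢y : x ≢ y
    x≢y = separated (~-sym w~x) (≁-sym w≁y)
    w≢y : w ≢ y
    w≢y = separated w~x (≁-sym x≁y)
    open Mate (mate lx ly x≢y x≁y) using (p; x~p; v≁p; y≁p; cp)
    open Mate (mate lz lw (separated z~y w≁y) (≁-sym w≁z)) using () renaming
      (p to t; p′ to t′; x~p to z~t; v≁p to v≁t; y≁p to w≁t;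
       p~p′ to t~t′; cp to ct; v≁p′ to v≁t′; x≁p′ to z≁t′)
    z~p : z ~ p
    z~p = mate-~ v~x v~y v~z x~p v≁p y≁p x≁y (~-sym x~z) z~y
    x~t : x ~ t
    x~t = mate-~ v~z v~w v~x z~t v≁t w≁t (≁-sym w≁z) x~z (~-sym w~x)
    x~t′ : x ~ t′
    x~t′ = second-~ v~z v~x z~t v≁t t~t′ v≁t′ z≁t′ x~z x~t
    y≁t : y ≁ t
    y≁t = mate-≁ v~z v~w v~y z~t v≁t w≁t (≁-sym w≁z) (~-sym z~y) (≁-sym w≁y)
    p≢t : p ≢ t
    p≢t = colours-≢ λ eq → lone-colours-≢ lw ly w≢y (trans (sym ct) (trans (sym eq) cp))
    p~t : p ~ t
    -- If `p ≁ t`, then `t′` is forced to see `p` and `y`, and is itself the centre of a chair with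
    -- leaves `p`, `t` and path `t′`, `y`, `v`.
    p~t = ¬≁⇒~ λ p≁t →
      let p~t′ = ¬≁⇒~ λ p≁t′ → chair (~-sym z~p) (~-sym v~z) z~t t~t′ (≁-sym v≁p) p≁t p≁t′ z≁t′
                                 v≁t v≁t′ (≢-sym (separated v~y (≁-sym y≁p)))
          y~t′ = ¬≁⇒~ λ y≁t′ → kite x~p x~t′ x~z (~-sym z~y) p~t′ (~-sym z~p) x≁y y≁p y≁t′
                                 (≁-sym z≁t′)
      in chair p~t′ (~-sym t~t′) (~-sym y~t′) (~-sym v~y) p≁t (≁-sym y≁p) (≁-sym v≁p)
           (≁-sym v≁t′) (≁-sym y≁t) (≁-sym v≁t) p≢t
    p≁t′ : p ≁ t′
    p≁t′ = ¬~⇒≁ λ p~t′ → kite p~t p~t′ (~-sym z~p) v~z t~t′ (~-sym z~t) (≁-sym v≁p) v≁t v≁t′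
                           (≁-sym z≁t′)
    y≁t′ : y ≁ t′
    y≁t′ = ¬~⇒≁ λ y~t′ → kite x~t x~p x~t′ y~t′ (~-sym p~t) t~t′ x≁y y≁t y≁p p≁t′

  -- Induced C4s among the lone vertices.

  -- The Kempe chains from x to y and from u to w begin with x, p, p′ and u, q, q′;
  -- in fact the next vertices are already y and w.
  record Square (x y u w : Fin m) : Set where
    field
      xy : Mate x y
      uw : Mate u w
    open Mate xy public
    open Mate uw public using () renaming
      (p to q; p′ to q′; x~p to u~q; p~p′ to q~q′;
       v≁p to v≁q; y≁p to w≁q; v≁p′ to v≁q′; x≁p′ to u≁q′)
    field
      lx  : Lone c x
      ly  : Lone c y
      lu  : Lone c u
      lw  : Lone c w
      x≢y : x ≢ y
      u≢w : u ≢ w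
      x≁y : x ≁ y
      u≁w : u ≁ w
      x~u : x ~ u
      x~w : x ~ w
      y~u : y ~ u
      y~w : y ~ w

  transposed : ∀ {x y u w} → Square x y u w → Square u w x y
  transposed sq = record
    { xy = uw ; uw = xy ; lx = lu ; ly = lw ; lu = lx ; lw = ly ; x≢y = u≢w ; u≢w = x≢y
    ; x≁y = u≁w ; u≁w = x≁y ; x~u = ~-sym x~u ; x~w = ~-sym y~u ; y~u = ~-sym x~w ; y~w = ~-sym y~w }
    where open Square sq

  module InSquare {x y u w} (sq : Square x y u w) where
    open Square sq using
      ( p; p′; q; q′; x~p; p~p′; v≁p; y≁p; v≁p′; x≁p′; cp′
      ; u~q; q~q′; v≁q; w≁q; v≁q′; u≁q′
      ; lx; ly; lu; lw; x≢y; u≢w; x≁y; u≁w; x~u; x~w; y~u; y~w )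

    v~x : v ~ x
    v~x = proj₁ lx
    v~y : v ~ y
    v~y = proj₁ ly
    v~u : v ~ u
    v~u = proj₁ lu
    v~w : v ~ w
    v~w = proj₁ lw
    p~u : p ~ u
    p~u = ~-sym (mate-~ v~x v~y v~u x~p v≁p y≁p x≁y (~-sym x~u) (~-sym y~u))
    p′~u : p′ ~ u
    p′~u = ~-sym (second-~ v~x v~u x~p v≁p p~p′ v≁p′ x≁p′ (~-sym x~u) (~-sym p~u))
    q~x : q ~ x
    q~x = ~-sym (mate-~ v~u v~w v~x u~q v≁q w≁q u≁w x~u x~w)
    q~y : q ~ y
    q~y = ~-sym (mate-~ v~u v~w v~y u~q v≁q w≁q u≁w y~u y~w)
    q′~x : q′ ~ x
    q′~x = ~-sym (second-~ v~u v~x u~q v≁q q~q′ v≁q′ u≁q′ x~u (~-sym q~x))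
    q′~y : q′ ~ y
    q′~y = ~-sym (second-~ v~u v~y u~q v≁q q~q′ v≁q′ u≁q′ y~u (~-sym q~y))

    -- This and the next three lemmas, one kite each, split the argument by whether `p′ ~ q′`.
    -- Either case supplies two disjoint non-edges between the pairs `p`, `p′` and `q`, `q′`, as the
    -- recolouring requires.
    p′~q′⇒p≁q′ : p′ ~ q′ → p ≁ q′
    p′~q′⇒p≁q′ p′~q′ = ¬~⇒≁ λ p~q′ → kite (~-sym p~p′) p′~q′ p′~u v~u p~q′ p~u (≁-sym v≁p′) v≁p
                                       v≁q′ (≁-sym u≁q′)

    p′~q′⇒p′≁q : p′ ~ q′ → p′ ≁ q
    p′~q′⇒p′≁q p′~q′ = ¬~⇒≁ λ p′~q → kite p′~q p′~q′ p′~u v~u q~q′ (~-sym u~q) (≁-sym v≁p′) v≁q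
                                       v≁q′ (≁-sym u≁q′)

    p′≁q′⇒p~q′ : p′ ≁ q′ → p ~ q′
    p′≁q′⇒p~q′ p′≁q′ = ¬≁⇒~ λ p≁q′ → kite p~u p~p′ (~-sym x~p) q′~x (~-sym p′~u) (~-sym x~u)
                                       p≁q′ (≁-sym u≁q′) (≁-sym p′≁q′) (≁-sym x≁p′)

    p′≁q′⇒p≁q : p′ ≁ q′ → p ≁ q
    p′≁q′⇒p≁q p′≁q′ = let p~q′ = p′≁q′⇒p~q′ p′≁q′ in ¬~⇒≁ λ p~q → kite p~q p~q′ p~u v~u q~q′
                                                                    (~-sym u~q) (≁-sym v≁p) v≁q
                                                                    v≁q′ (≁-sym u≁q′)

    yx : Mate y x
    yx = mate ly lx (≢-sym x≢y) (≁-sym x≁y)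

    open Mate yx using () renaming
      (p to s; x~p to y~s; v≁p to v≁s; y≁p to x≁s; cp to cs; only to only-s)

    -- This closes the chain after four vertices. If `y ≁ p′`, then `p` misses the mate `s` of `y`,
    -- or else it is the centre of a chair with leaves `x`, `p′` and path `p`, `s`, `y`. If
    -- `p′ ~ q′`, a chair forces `q′ ~ s` and another one arises at `x`; if not, a chair forces
    -- `q′ ≁ s` and `s` hangs at `u` on the diamond with tips `q′`, `u`.
    y~p′ : y ~ p′
    y~p′ = ¬≁⇒~ λ y≁p′ →
      let s≁p′ = same-colour-≁ (trans cs (sym cp′))
          p′≢x = ≢-sym (separated (~-sym v~x) (≁-sym v≁p′))
          s~u = ~-sym (mate-~ v~y v~x v~u y~s v≁s x≁s (≁-sym x≁y) (~-sym y~u) (~-sym x~u))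
          p≁s = ¬~⇒≁ λ p~s → chair (~-sym p~p′) (~-sym x~p) p~s (~-sym y~s) (≁-sym x≁p′)
                               (≁-sym s≁p′) (≁-sym y≁p′) (≁-sym y≁p) x≁s x≁y p′≢x
      in case ~-or-≁ p′ q′ of λ
        { (inj₁ p′~q′) →
            let p≁q′ = p′~q′⇒p≁q′ p′~q′
                q′~s = ¬≁⇒~ λ q′≁s → chair p′~q′ q′~x q′~y y~s (≁-sym x≁p′) (≁-sym y≁p′)
                                       (≁-sym s≁p′) q′≁s x≁y x≁s p′≢x
            in chair (~-sym x~p) (~-sym v~x) (~-sym q′~x) q′~s (≁-sym v≁p) p≁q′ p≁s x≁s v≁q′ v≁s
                 (≢-sym (separated v~y (≁-sym y≁p)))
        ; (inj₂ p′≁q′) →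
            let p~q′ = p′≁q′⇒p~q′ p′≁q′
                q′≁s = ¬~⇒≁ λ q′~s → chair p′~u (~-sym v~u) (~-sym s~u) (~-sym q′~s)
                                       (≁-sym v≁p′) (≁-sym s≁p′) p′≁q′ u≁q′ v≁s v≁q′
                                       (≢-sym (separated v~x (≁-sym x≁p′)))
            in kite (~-sym x~p) p~q′ p~u s~u (~-sym q′~x) x~u p≁s (≁-sym x≁s) (≁-sym q′≁s)
                 (≁-sym u≁q′) }

    p′≡s : p′ ≡ s
    p′≡s = only-s y~p′ cp′

    -- In the flipped square this lets `q′` take the colour of `y`. A further vertex `g` of the
    -- colour that sees `q′` gives a chair centred at `q′` if `p′ ~ q′`, and at `y` otherwise.
    other-≁q′ : ∀ {g} → c g ≡ c x → g ≢ x → g ≢ p′ → g ≁ q′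
    other-≁q′ {g} cg g≢x g≢p′ = ¬~⇒≁ λ g~q′ → case ~-or-≁ p′ q′ of λ
      { (inj₁ p′~q′) → chair p′~q′ (~-sym g~q′) q′~x (~-sym v~x) (≁-sym g≁p′) (≁-sym x≁p′)
                         (≁-sym v≁p′) (≁-sym v≁q′) g≁x (≁-sym v≁g) (≢-sym g≢p′)
      ; (inj₂ p′≁q′) → chair (~-sym y~p′) (~-sym v~y) (~-sym q′~y) (~-sym g~q′) (≁-sym v≁p′)
                         p′≁q′ (≁-sym g≁p′) (≁-sym g≁y) v≁q′ v≁g
                         (≢-sym (separated v~x (≁-sym x≁p′))) }
      where
      g≁x : g ≁ x
      g≁x = same-colour-≁ cg
      g≁p′ : g ≁ p′
      g≁p′ = same-colour-≁ (trans cg (sym cp′))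
      v≁g : v ≁ g
      v≁g = lone-≁ lx cg g≢x
      g≁y : g ≁ y
      g≁y = ¬~⇒≁ λ g~y → g≢p′ (trans (only-s (~-sym g~y) cg) (sym p′≡s))

  flipped : ∀ {x y u w} → Square x y u w → Square y x u w
  flipped sq = record
    { xy = mate ly lx (≢-sym x≢y) (≁-sym x≁y) ; uw = uw ; lx = ly ; ly = lx ; lu = lu ; lw = lw
    ; x≢y = ≢-sym x≢y ; u≢w = u≢w ; x≁y = ≁-sym x≁y ; u≁w = u≁w
    ; x~u = y~u ; x~w = y~w ; y~u = x~u ; y~w = x~w }
    where open Square sq

  -- The chains read backwards from y are y, p′, p, x.
  flipped-p′≡p : ∀ {x y u w} (sq : Square x y u w) → Square.p′ (flipped sq) ≡ Square.p sq
  flipped-p′≡p sq = Square.only sq (InSquare.y~p′ (flipped sq)) (Square.cp′ (flipped sq))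

  flipped-p≡p′ : ∀ {x y u w} (sq : Square x y u w) → Square.p (flipped sq) ≡ Square.p′ sq
  flipped-p≡p′ sq = sym (InSquare.p′≡s sq)

  -- The colours of x, y, u, w are redistributed over the independent sets
  -- {x, y}, {v, p, q′}, {u, w} and {p′, q}, and colour zero disappears.
  no-unmatched-square : ∀ {x y u w} (sq : Square x y u w) →
                        Square.p sq ≁ Square.q′ sq → Square.p′ sq ≁ Square.q sq → ⊥
  no-unmatched-square {x} {y} {u} {w} sq p≁q′ p′≁q = step₇ (every-colour-used step₆ zero)
    where
    open Square sq using
      (p; p′; q; q′; lx; ly; lu; lw; x≢y; u≢w; x~u; x~w; y~u; y~w; v≁p′; v≁q′)
    cx≢cy : c x ≢ c y
    cx≢cy = lone-colours-≢ lx ly x≢y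
    cx≢cu : c x ≢ c u
    cx≢cu = lone-colours-≢ lx lu (~⇒≢ x~u)
    cx≢cw : c x ≢ c w
    cx≢cw = lone-colours-≢ lx lw (~⇒≢ x~w)
    cy≢cu : c y ≢ c u
    cy≢cu = lone-colours-≢ ly lu (~⇒≢ y~u)
    cy≢cw : c y ≢ c w
    cy≢cw = lone-colours-≢ ly lw (~⇒≢ y~w)
    cu≢cw : c u ≢ c w
    cu≢cw = lone-colours-≢ lu lw u≢w
    0≢ : ∀ {a} → Lone c a → zero ≢ c a
    0≢ la = ≢-sym (lone-≢0 solo la)

    y-sees-only : ∀ {b} → y ~ b → c b ≡ c x → b ≡ p′
    y-sees-only y~b cb = trans (Mate.only (InSquare.yx sq) y~b cb) (sym (InSquare.p′≡s sq))
    w-sees-only : ∀ {b} → w ~ b → c b ≡ c u → b ≡ q′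
    w-sees-only w~b cb = trans (Mate.only (InSquare.yx (transposed sq)) w~b cb)
                               (sym (InSquare.p′≡s (transposed sq)))
    q′-misses : ∀ {b} → b ≢ y → c b ≡ c y → q′ ≁ b
    q′-misses {b} b≢y cb with b ≟ p
    ... | yes refl = ≁-sym p≁q′
    ... | no b≢p   = ≁-sym (InSquare.other-≁q′ (flipped sq) cb b≢y
                       (λ eq → b≢p (trans eq (flipped-p′≡p sq))))
    p′-misses : ∀ {b} → b ≢ w → c b ≡ c w → p′ ≁ b
    p′-misses {b} b≢w cb with b ≟ q
    ... | yes refl = p′≁q
    ... | no b≢q   = ≁-sym (InSquare.other-≁q′ (flipped (transposed sq)) cb b≢w
                       (λ eq → b≢q (trans eq (flipped-p′≡p (transposed sq)))))

    c₁ c₂ c₃ c₄ c₅ c₆ : Colouring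
    -- Before `y` can take the colour of `x`, its neighbour `p′` must give it up; but `p′` can take
    -- the colour of `w` only after `w` has moved. Colour zero parks it meanwhile.
    c₁ = recolour c p′ zero
    c₂ = recolour c₁ y (c x)
    c₃ = recolour c₂ q′ (c y)
    c₄ = recolour c₃ w (c u)
    c₅ = recolour c₄ v (c y)
    c₆ = recolour c₅ p′ (c w)

    step₁ : IsProperColouring G c₁
    step₁ = recolour-proper proper λ p′~b cb≡0 →
      ~⇒¬≁ (subst (p′ ~_) (only-v cb≡0) p′~b) (≁-sym v≁p′)
    step₂ : IsProperColouring G c₂
    step₂ = recolour-proper step₁ λ y~b eq →
      let b≢p′ , cb = recolour-keep {c} (0≢ lx) eq in b≢p′ (y-sees-only y~b cb)
    step₃ : IsProperColouring G c₃
    step₃ = recolour-proper step₂ λ q′~b eq₂ →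
      let b≢y , eq₁ = recolour-keep {c₁} cx≢cy eq₂
          _ , cb    = recolour-keep {c} (0≢ ly) eq₁
      in ~⇒¬≁ q′~b (q′-misses b≢y cb)
    step₄ : IsProperColouring G c₄
    step₄ = recolour-proper step₃ λ w~b eq₃ →
      let b≢q′ , eq₂ = recolour-keep {c₂} cy≢cu eq₃
          _ , eq₁    = recolour-keep {c₁} cx≢cu eq₂
          _ , cb     = recolour-keep {c} (0≢ lu) eq₁
      in b≢q′ (w-sees-only w~b cb)
    step₅ : IsProperColouring G c₅
    step₅ = recolour-proper step₄ λ {b} v~b eq₄ →
      let _ , eq₃ = recolour-keep {c₃} (≢-sym cy≢cu) eq₄
      in case recolour-inv {c₂} {q′} {c y} {b} eq₃ of λ
        { (inj₁ (b≡q′ , _)) → ~⇒¬≁ (subst (v ~_) b≡q′ v~b) v≁q′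
        ; (inj₂ (_ , eq₂)) →
            let b≢y , eq₁ = recolour-keep {c₁} cx≢cy eq₂
                _ , cb    = recolour-keep {c} (0≢ ly) eq₁
            in b≢y (proj₂ ly v~b cb) }
    step₆ : IsProperColouring G c₆
    step₆ = recolour-proper step₅ λ p′~b eq₅ →
      let _ , eq₄   = recolour-keep {c₄} cy≢cw eq₅
          b≢w , eq₃ = recolour-keep {c₃} cu≢cw eq₄
          _ , eq₂   = recolour-keep {c₂} cy≢cw eq₃
          _ , eq₁   = recolour-keep {c₁} cx≢cw eq₂
          _ , cb    = recolour-keep {c} (0≢ lw) eq₁
      in ~⇒¬≁ p′~b (p′-misses b≢w cb)
    step₇ : ¬ ∃ λ a → c₆ a ≡ zero
    step₇ (a , eq₆) =
      let a≢p′ , eq₅ = recolour-keep {c₅} (lone-≢0 solo lw) eq₆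
          a≢v , eq₄  = recolour-keep {c₄} (lone-≢0 solo ly) eq₅
          _ , eq₃    = recolour-keep {c₃} (lone-≢0 solo lu) eq₄
          _ , eq₂    = recolour-keep {c₂} (lone-≢0 solo ly) eq₃
          _ , eq₁    = recolour-keep {c₁} (lone-≢0 solo lx) eq₂
      in case recolour-inv {c} {p′} {zero} {a} eq₁ of λ
        { (inj₁ (a≡p′ , _)) → a≢p′ a≡p′
        ; (inj₂ (_ , ca))   → a≢v (only-v ca) }

  no-square : ∀ {x y u w} → ¬ Square x y u w
  no-square sq with ~-or-≁ (Square.p′ sq) (Square.q′ sq)
  ... | inj₁ p′~q′ = no-unmatched-square sq
      (InSquare.p′~q′⇒p≁q′ sq p′~q′)
      (InSquare.p′~q′⇒p′≁q sq p′~q′)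
  -- Reading the chain from `u` to `w` backwards exchanges `q` and `q′`, which turns the available
  -- non-edges into the required ones.
  ... | inj₂ p′≁q′ = no-unmatched-square (transposed (flipped (transposed sq)))
      (subst (Square.p sq ≁_) (sym (flipped-p′≡p (transposed sq))) (InSquare.p′≁q′⇒p≁q sq p′≁q′))
      (subst (Square.p′ sq ≁_) (sym (flipped-p≡p′ (transposed sq))) p′≁q′)

  no-lone-C4 : ∀ {x y u w} → Lone c x → Lone c y → Lone c u → Lone c w → x ≢ y → u ≢ w →
               x ≁ y → u ≁ w → x ~ u → x ~ w → y ~ u → y ~ w → ⊥
  no-lone-C4 lx ly lu lw x≢y u≢w x≁y u≁w x~u x~w y~u y~w = no-square (record
    { xy = mate lx ly x≢y x≁y ; uw = mate lu lw u≢w u≁w ; lx = lx ; ly = ly ; lu = lu ; lw = lw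
    ; x≢y = x≢y ; u≢w = u≢w ; x≁y = x≁y ; u≁w = u≁w ; x~u = x~u ; x~w = x~w ; y~u = y~u ; y~w = y~w })

  -- The whole Kempe chain between two lone vertices.

  module KempePath {z y : Fin m} (lz : Lone c z) (ly : Lone c y) (z≢y : z ≢ y) (z≁y : z ≁ y) where

    Kempe : Fin m → Fin m → Set
    Kempe a b = a ~ b × OneOf (c z) (c y) (c a) × OneOf (c z) (c y) (c b)

    Kempe-sym : ∀ {a b} → Kempe a b → Kempe b a
    Kempe-sym (a~b , ka , kb) = ~-sym a~b , kb , ka

    Kempe? : ∀ a b → Dec (Kempe a b)
    Kempe? a b = (a ~? b) ×-dec one-of? (c a) ×-dec one-of? (c b)
      where
      one-of? : ∀ κ → Dec (OneOf (c z) (c y) κ)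
      one-of? κ = (κ ≟ c z) ⊎-dec (κ ≟ c y)

    two-colours : ∀ {a b d} → Kempe a b → Kempe a d → c b ≡ c d
    two-colours (a~b , _ , inj₁ p) (_ , _ , inj₁ q) = trans p (sym q)
    two-colours (a~b , _ , inj₂ p) (_ , _ , inj₂ q) = trans p (sym q)
    two-colours (a~b , inj₁ r , inj₁ p) (_ , _ , inj₂ q) = contradiction (trans r (sym p)) (proper _ _ a~b)
    two-colours (a~b , inj₂ r , inj₁ p) (a~d , _ , inj₂ q) = contradiction (trans r (sym q)) (proper _ _ a~d)
    two-colours (a~b , inj₁ r , inj₂ p) (a~d , _ , inj₁ q) = contradiction (trans r (sym q)) (proper _ _ a~d)
    two-colours (a~b , inj₂ r , inj₂ p) (_ , _ , inj₁ q) = contradiction (trans r (sym p)) (proper _ _ a~b)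

    z-nbr-colour : ∀ {b} → Kempe z b → c b ≡ c y
    z-nbr-colour (z~b , _ , inj₁ eq) = contradiction (sym eq) (proper _ _ z~b)
    z-nbr-colour (z~b , _ , inj₂ eq) = eq

    -- Path b a l: the chain starting at z reads l (last vertex first), a, b, and
    -- every vertex before b has no Kempe neighbours besides its chain neighbours.
    data Path : Fin m → Fin m → List (Fin m) → Set where
      start : ∀ {b} → Kempe z b → (∀ {d} → Kempe z d → d ≡ b) → Path b z []
      step  : ∀ {a b d l} → Path b a l → Kempe b d → d ≢ a →
              (∀ {e} → Kempe b e → e ≡ a ⊎ e ≡ d) → Path d b (a ∷ l)

    last-edge : ∀ {a b l} → Path b a l → Kempe a b
    last-edge (start kzb _)    = kzb
    last-edge (step _ kbd _ _) = kbd

    closed-before-end : ∀ {a b l u w} → Path b a l → u ∈ a ∷ l → Kempe u w → w ∈ b ∷ a ∷ l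
    closed-before-end (start _ only) (here refl) kuw = here (only kuw)
    closed-before-end (step _ _ _ only) (here refl) kuw with only kuw
    ... | inj₁ eq = there (there (here eq))
    ... | inj₂ eq = here eq
    closed-before-end (step path _ _ _) (there u∈) kuw = there (closed-before-end path u∈ kuw)

    -- All Kempe neighbours of the vertices before `a` lie on the chain up to `a`. So if the new
    -- vertex `d` were among those, its neighbour `b` would already have occurred.
    end∉ : ∀ {a b l} → Path b a l → b ∉ a ∷ l
    next∉ : ∀ {a b d l} → Path b a l → Kempe b d → d ≢ a → d ∉ b ∷ a ∷ l
    end∉ (start kzb _) (here refl)    = ~⇒≢ (proj₁ kzb) refl
    end∉ (step path kbd d≢a _)        = next∉ path kbd d≢a
    next∉ path kbd d≢a (here refl)         = ~⇒≢ (proj₁ kbd) refl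
    next∉ path kbd d≢a (there (here refl)) = d≢a refl
    next∉ path@(step before _ _ _) kbd d≢a (there (there d∈)) =
      end∉ path (closed-before-end before d∈ (Kempe-sym kbd))

    Path⇒Unique : ∀ {a b l} → Path b a l → Unique (b ∷ a ∷ l)
    Path⇒Unique path@(start _ _)         = ¬Any⇒All¬ _ (end∉ path) ∷ [] ∷ []
    Path⇒Unique path@(step before _ _ _) = ¬Any⇒All¬ _ (end∉ path) ∷ Path⇒Unique before

    -- Two continuations `d`, `e` would be the leaves of a chair with centre `b` whose path runs two
    -- steps back along the chain. At the start, `v` serves as the vertex before `z`.
    no-branching : ∀ {a b d e l} → Path b a l → Kempe b d → Kempe b e → d ≢ a → e ≢ a → d ≡ e
    no-branching {b = b} {d} {e} path@(start kzb@(z~b , _) _) kbd@(b~d , _) kbe@(b~e , _) d≢z e≢z =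
      decidable-stable (d ≟ e) λ d≢e → chair (~-sym b~d) b~e (~-sym z~b) (~-sym v~z) d≁e d≁z
                                         (≁-sym v≁d) (≁-sym v≁b) e≁z (≁-sym v≁e) d≢e
      where
      v~z : v ~ z
      v~z = proj₁ lz
      cb≡cy : c b ≡ c y
      cb≡cy = z-nbr-colour kzb
      cd≡cz : c d ≡ c z
      cd≡cz = two-colours kbd (Kempe-sym kzb)
      ce≡cz : c e ≡ c z
      ce≡cz = two-colours kbe (Kempe-sym kzb)
      v≁b : v ≁ b
      v≁b = lone-≁ ly cb≡cy (separated (~-sym z~b) (≁-sym z≁y))
      d≁e : d ≁ e
      d≁e = same-colour-≁ (two-colours kbd kbe)
      d≁z : d ≁ z
      d≁z = same-colour-≁ cd≡cz
      e≁z : e ≁ z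
      e≁z = same-colour-≁ ce≡cz
      v≁d : v ≁ d
      v≁d = lone-≁ lz cd≡cz d≢z
      v≁e : v ≁ e
      v≁e = lone-≁ lz ce≡cz e≢z
    no-branching {a} {b} {d} {e} path@(step {a = a₀} before kab@(a~b , _) _ _)
                 kbd@(b~d , _ , kd) kbe@(b~e , _ , ke) d≢a e≢a =
      decidable-stable (d ≟ e) λ d≢e → chair (~-sym b~d) b~e (~-sym a~b) (~-sym a₀~a) d≁e d≁a
                                         (≁-sym a₀≁d) b≁a₀ e≁a (≁-sym a₀≁e) d≢e
      where
      ka₀a : Kempe a₀ a
      ka₀a = last-edge before
      a₀~a : a₀ ~ a
      a₀~a = proj₁ ka₀a
      d≁e : d ≁ e
      d≁e = same-colour-≁ (two-colours kbd kbe)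
      d≁a : d ≁ a
      d≁a = same-colour-≁ (two-colours kbd (Kempe-sym kab))
      e≁a : e ≁ a
      e≁a = same-colour-≁ (two-colours kbe (Kempe-sym kab))
      b≁a₀ : b ≁ a₀
      b≁a₀ = same-colour-≁ (two-colours kab (Kempe-sym ka₀a))
      a₀-misses : ∀ {g} → Kempe b g → g ≢ a → a₀ ≁ g
      a₀-misses kbg g≢a = ¬~⇒≁ λ a₀~g → next∉ path kbg g≢a
        (there (closed-before-end before (here refl) (a₀~g , proj₁ (proj₂ ka₀a) , proj₂ (proj₂ kbg))))
      a₀≁d : a₀ ≁ d
      a₀≁d = a₀-misses kbd d≢a
      a₀≁e : a₀ ≁ e
      a₀≁e = a₀-misses kbe e≢a

    record FullPath : Set where
      constructor full
      field
        {end before-end} : Fin m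
        {rest}           : List (Fin m)
        path             : Path end before-end rest
        stops            : ∀ {w} → Kempe end w → w ≡ before-end

    opaque
      extend : ∀ {a b l} (fuel : ℕ) → m ≤ length l + fuel → Path b a l → FullPath
      extend {a} {b} {l} fuel bound path with any? (λ d → Kempe? b d ×-dec ¬? (d ≟ a))
      ... | no none = full path λ kbw → decidable-stable (_ ≟ a) λ w≢a → none (_ , kbw , w≢a)
      -- With no fuel left, `m ≤ length l`, yet the chain has `length l + 2` distinct vertices.
      extend {l = l} zero bound path | yes _ =
        contradiction (≤-trans (length≤n (Path⇒Unique path)) (≤-trans bound (≤-reflexive (+-identityʳ _))))
                      (<⇒≱ (s≤s (n≤1+n (length l))))
      extend {a} {b} {l} (suc fuel) bound path | yes (d , kbd , d≢a) =
        extend fuel (≤-trans bound (≤-reflexive (+-suc (length l) fuel))) (step path kbd d≢a only)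
        where
        only : ∀ {e} → Kempe b e → e ≡ a ⊎ e ≡ d
        only {e} kbe with e ≟ a
        ... | yes e≡a = inj₁ e≡a
        ... | no e≢a  = inj₂ (no-branching path kbe kbd e≢a d≢a)

    start∈ : ∀ {a b l} → Path b a l → z ∈ b ∷ a ∷ l
    start∈ (start _ _)         = there (here refl)
    start∈ (step before _ _ _) = there (start∈ before)

    interior : ∀ {a b l u} → Path b a l → u ∈ b ∷ a ∷ l → u ≢ z → u ≢ b →
               ∃ λ d → ∃ λ e → d ≢ e × Kempe u d × Kempe u e
    interior (start _ _) (here refl) _ u≢b         = contradiction refl u≢b
    interior (start _ _) (there (here refl)) u≢z _ = contradiction refl u≢z
    interior (step _ _ _ _) (here refl) _ u≢b      = contradiction refl u≢b
    interior {b = b} {u = u} (step {a = a₀} {b = a} before kab b≢a₀ _) (there u∈) u≢z _ with u ≟ a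
    ... | yes refl = b , a₀ , b≢a₀ , kab , Kempe-sym (last-edge before)
    ... | no u≢a   = interior before u∈ u≢z u≢a

    opaque
      -- The list is the maximal chain from `z`. It contains `y` by `kempe-linked`, and `y` must be
      -- its end because `y` has only one Kempe neighbour.
      kempe-path : ∃ λ L → KempeClosed c (c z) (c y) (_∈ L) × z ∈ L ×
                   (∀ {u} → u ∈ L → u ≢ z → u ≢ y → ∃ λ d → ∃ λ e → d ≢ e × Kempe u d × Kempe u e)
      kempe-path = L , closed , start∈ path ,
        λ u∈ u≢z u≢y → interior path u∈ u≢z (λ u≡end → u≢y (trans u≡end (sym y≡end)))
        where
        first : Mate z y
        first = mate lz ly z≢y z≁y
        first-kempe : Kempe z (Mate.p first)
        first-kempe = Mate.x~p first , inj₁ refl , inj₂ (Mate.cp first)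
        open FullPath (extend m ≤-refl (start first-kempe λ
          kzd → Mate.only first (proj₁ kzd) (z-nbr-colour kzd)))
        L : List (Fin m)
        L = end ∷ before-end ∷ rest
        closed : KempeClosed c (c z) (c y) (_∈ L)
        closed (here refl) a~b ka kb = there (here (stops (a~b , ka , kb)))
        closed (there a∈) a~b ka kb  = closed-before-end path a∈ (a~b , ka , kb)
        y∈L : y ∈ L
        y∈L = decidable-stable (y ∈? L) (kempe-linked solo lz ly (_∈? L) closed (start∈ path))
        open Mate (mate ly lz (≢-sym z≢y) (≁-sym z≁y)) using (p; only; x~p; cp)
        y-nbr : ∀ {d} → Kempe y d → d ≡ p
        y-nbr kyd = only (proj₁ kyd) (trans (two-colours kyd (x~p , inj₂ refl , inj₁ cp)) cp)
        y≡end : y ≡ end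
        y≡end = decidable-stable (y ≟ end) λ y≢end →
          let _ , _ , d≢e , kyd , kye = interior path y∈L (≢-sym z≢y) y≢end
          in d≢e (trans (y-nbr kyd) (sym (y-nbr kye)))

  -- Otherwise swap the colours of z and y off the Kempe path from z to y. The mate of x
  -- lies off this path, so x loses its only neighbour with the colour of y.
  second-neighbour : ∀ {x z y} → Lone c x → Lone c z → Lone c y → x ~ z → x ≁ y → z ≁ y →
                     ∃ λ g → x ~ g × c g ≡ c z × g ≢ z
  second-neighbour {x} {z} {y} lx@(v~x , only-x) lz@(v~z , _) ly@(v~y , _) x~z x≁y z≁y =
    decidable-stable (any? (λ g → (x ~? g) ×-dec (c g ≟ c z) ×-dec ¬? (g ≟ z))) contra
    where
    x≢y : x ≢ y
    x≢y = separated x~z (≁-sym z≁y)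
    z≢y : z ≢ y
    z≢y = separated (~-sym x~z) (≁-sym x≁y)
    open Mate (mate lx ly x≢y x≁y)
    open KempePath lz ly z≢y z≁y
    z≁p : z ≁ p
    z≁p = mate-≁ v~x v~y v~z x~p v≁p y≁p x≁y (~-sym x~z) z≁y
    cx≢cy : c x ≢ c y
    cx≢cy = lone-colours-≢ lx ly x≢y
    cx≢cz : c x ≢ c z
    cx≢cz = lone-colours-≢ lx lz (~⇒≢ x~z)
    contra : ¬ ¬ ∃ λ g → x ~ g × c g ≡ c z × g ≢ z
    contra none with kempe-path
    ... | L , closed , z∈L , inside = ⊥-elim impossible
      where
      x-sees-only : ∀ {g} → x ~ g → c g ≡ c z → g ≡ z
      x-sees-only x~g cg = decidable-stable (_ ≟ z) λ g≢z → none (_ , x~g , cg , g≢z)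
      p-nbr : ∀ {d} → Kempe p d → c d ≡ c z
      p-nbr (p~d , _ , inj₁ eq) = eq
      p-nbr (p~d , _ , inj₂ eq) = contradiction (trans cp (sym eq)) (proper _ _ p~d)
      x-misses : ∀ {d} → Kempe p d → x ≁ d
      x-misses kpd@(p~d , _) = ¬~⇒≁ λ x~d →
        ~⇒¬≁ p~d (subst (p ≁_) (sym (x-sees-only x~d (p-nbr kpd))) (≁-sym z≁p))
      v-misses : ∀ {d} → Kempe p d → v ≁ d
      v-misses kpd@(p~d , _) = lone-≁ lz (p-nbr kpd) (separated (~-sym p~d) z≁p)
      -- On the path, `p` would have two Kempe neighbours, both missed by `x` and `v`: a chair with
      -- centre `p` and path `p`, `x`, `v`.
      p∉L : p ∉ L
      p∉L p∈L with inside p∈L (≢-sym (separated (~-sym v~z) (≁-sym v≁p))) (≢-sym (separated (~-sym v~y) (≁-sym v≁p)))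
      ... | d , e , d≢e , kpd@(p~d , _) , kpe@(p~e , _) =
        let d≁e = same-colour-≁ (two-colours kpd kpe)
            x≁d = x-misses kpd
            x≁e = x-misses kpe
            v≁d = v-misses kpd
            v≁e = v-misses kpe
        in chair (~-sym p~d) p~e (~-sym x~p) (~-sym v~x) d≁e (≁-sym x≁d) (≁-sym v≁d) (≁-sym v≁p)
             (≁-sym x≁e) (≁-sym v≁e) d≢e
      off? : Decidable (_∉ L)
      off? a = ¬? (a ∈? L)
      c′ : Colouring
      c′ = kempe-swap off? (c z) (c y) c
      solo′ : Solo c′
      solo′ = kempe-swap-solo off? (c z) (c y) c solo (lone-≢0 solo lz) (lone-≢0 solo ly) (KempeClosed-∁ closed)
      c′x : c′ x ≡ c x
      c′x with kempe-swap-cases off? (c z) (c y) c x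
      ... | inj₁ (_ , q) = trans q (transpose-other cx≢cz cx≢cy)
      ... | inj₂ (_ , q) = q
      lone′ : Lone c′ x
      lone′ = v~x , λ v~a eq → only-x v~a
        (kempe-swap-other off? (c z) (c y) c cx≢cz cx≢cy (trans eq c′x))
      impossible : ⊥
      -- Nor does `x` gain a neighbour in the colour of `y`: its only neighbour coloured like `z` is
      -- `z`, which lies on the path and keeps its colour.
      impossible with lone-sees-colour solo′ lone′ (c y) (lone-≢0 solo ly) (λ eq → cx≢cy (sym (trans eq c′x)))
      ... | b , x~b , eq with kempe-swap-cases off? (c z) (c y) c b
      ...   | inj₂ (b∈L , q) = b∈L λ b∈ → p∉L (subst (_∈ L) (only x~b (trans (sym q) eq)) b∈)
      ...   | inj₁ (b∉L , q) = b∉L (subst (_∈ L) (sym (x-sees-only x~b (transpose-injective (c z) (c y)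
                (trans (trans (sym q) eq) (sym (transpose-left (c z) (c y))))))) z∈L)

  -- Two disjoint edges with nothing in between: a clique of representatives.

  module TwoEdges {x z y w : Fin m}
                  (lx : Lone c x) (lz : Lone c z) (ly : Lone c y) (lw : Lone c w)
                  (x~z : x ~ z) (y~w : y ~ w)
                  (x≁y : x ≁ y) (x≁w : x ≁ w) (z≁y : z ≁ y) (z≁w : z ≁ w) where

    v~x : v ~ x
    v~x = proj₁ lx
    v~y : v ~ y
    v~y = proj₁ ly
    v~z : v ~ z
    v~z = proj₁ lz
    v~w : v ~ w
    v~w = proj₁ lw

    x≢y : x ≢ y
    x≢y = separated x~z (≁-sym z≁y)
    x≢w : x ≢ w
    x≢w = separated x~z (≁-sym z≁w)

    -- Every lone vertex other than `x` is of one of these kinds. If `v` is an edge of a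
    -- triangle-free graph, `Near` ones share with `v` the same end as `x`, `Far` ones the other
    -- end, and `Both` does not occur.
    Far Near Both : Fin m → Set
    Far s  = x ≢ s × x ≁ s
    Near t = x ~ t × y ≁ t
    Both i = x ~ i × y ~ i

    far-~y : ∀ {s} → Lone c s → Far s → s ≢ y → s ~ y
    far-~y ls (x≢s , x≁s) s≢y = ¬≁⇒~ (no-lone-triple lx ls ly x≢s x≢y s≢y x≁s x≁y)

    near-≁-far : ∀ {s t} → Lone c s → Far s → Lone c t → Near t → t ≁ s
    near-≁-far {s} ls far@(_ , x≁s) lt (x~t , y≁t) = ¬~⇒≁ λ t~s →
      no-lone-P4 lx lt ls ly x~t t~s (far-~y ls far (separated (~-sym t~s) y≁t)) x≁s x≁y (≁-sym y≁t)

    both-~-far : ∀ {s i} → Lone c s → Far s → Lone c i → Both i → i ~ s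
    both-~-far {s} ls far@(_ , x≁s) li (x~i , y~i) with s ≟ y
    ... | yes refl = ~-sym y~i
    ... | no s≢y   = ¬≁⇒~ λ i≁s →
      no-lone-P4 lx li ly ls x~i (~-sym y~i) (~-sym (far-~y ls far s≢y)) x≁y x≁s i≁s

    -- A neighbour of x (or x itself) that represents the colour of s; in the line graph of a
    -- triangle-free graph these would be the edges at the end of x not shared with v.
    data Rep (s : Fin m) : Fin m → Set where
      itself : s ≡ x → Rep s x
      far    : ∀ {a} → Far s → x ~ a → c a ≡ c s → Rep s a
      near   : ∀ {a} → Near s → x ~ a → c a ≡ c s → a ≢ s → Rep s a
      both   : Both s → Rep s s

    representative : ∀ {s} → Lone c s → ∃ (Rep s)
    representative {s} ls with s ≟ x | ~-or-≁ x s | ~-or-≁ y s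
    ... | yes s≡x | _ | _ = x , itself s≡x
    ... | no s≢x | inj₂ x≁s | _ = _ , far (≢-sym s≢x , x≁s) x~p cp
      where open Mate (mate lx ls (≢-sym s≢x) x≁s)
    ... | no _ | inj₁ x~s | inj₁ y~s = s , both (x~s , y~s)
    ... | no _ | inj₁ x~s | inj₂ y≁s with second-neighbour lx ls ly x~s x≁y (≁-sym y≁s)
    ...   | g , x~g , cg , g≢s = g , near (x~s , y≁s) x~g cg g≢s

    far-v≁ : ∀ {s a} → Lone c s → Far s → x ~ a → c a ≡ c s → v ≁ a
    far-v≁ ls (_ , x≁s) x~a ca = lone-≁ ls ca (separated (~-sym x~a) (≁-sym x≁s))

    near-≁-rep : ∀ {s t a} → Lone c s → Far s → x ~ a → c a ≡ c s → Lone c t → Near t → t ≁ a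
    near-≁-rep ls fs x~a ca lt nt =
      mate-≁ v~x (proj₁ ls) (proj₁ lt) x~a (far-v≁ ls fs x~a ca) (same-colour-≁ (sym ca)) (proj₂ fs)
             (~-sym (proj₁ nt)) (near-≁-far ls fs lt nt)

    -- If `a ≁ a′`, the chair centred at `x` with leaves `a`, `a′` and path `x`, `v`, `s′` is
    -- avoided only by `s′ ~ a`; then `z`, `a′` are the leaves of a chair with path `x`, `a`, `s′`.
    -- In `far-near`, `t` plays the part of `z`.
    far-far : ∀ {s s′ a a′} → Lone c s → Lone c s′ → s ≢ s′ → Far s → x ~ a → c a ≡ c s →
              Far s′ → x ~ a′ → c a′ ≡ c s′ → a ~ a′
    far-far {s} {s′} {a} {a′} ls ls′ s≢s′ fs@(_ , x≁s) x~a ca fs′@(_ , x≁s′) x~a′ ca′ = ¬≁⇒~ λ a≁a′ →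
      let s′~a = ¬≁⇒~ λ s′≁a → chair (~-sym x~a′) x~a (~-sym v~x) v~s′ (≁-sym a≁a′) (≁-sym v≁a′)
                                 a′≁s′ x≁s′ (≁-sym v≁a) (≁-sym s′≁a) a′≢a
      in chair (~-sym x~a′) x~z x~a (~-sym s′~a) (≁-sym z≁a′) (≁-sym a≁a′) a′≁s′ x≁s′ z≁a z≁s′
           (≢-sym (separated (~-sym v~z) (≁-sym v≁a′)))
      where
      v~s′ : v ~ s′
      v~s′ = proj₁ ls′
      a′≢a : a′ ≢ a
      a′≢a = colours-≢ λ eq → lone-colours-≢ ls ls′ s≢s′ (trans (sym ca) (trans (sym eq) ca′))
      v≁a : v ≁ a
      v≁a = far-v≁ ls fs x~a ca
      v≁a′ : v ≁ a′
      v≁a′ = far-v≁ ls′ fs′ x~a′ ca′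
      a′≁s′ : a′ ≁ s′
      a′≁s′ = same-colour-≁ ca′
      z≁s′ : z ≁ s′
      z≁s′ = near-≁-far ls′ fs′ lz (x~z , ≁-sym z≁y)
      z≁a : z ≁ a
      z≁a = near-≁-rep ls fs x~a ca lz (x~z , ≁-sym z≁y)
      z≁a′ : z ≁ a′
      z≁a′ = near-≁-rep ls′ fs′ x~a′ ca′ lz (x~z , ≁-sym z≁y)

    far-near : ∀ {s t a g} → Lone c s → Lone c t → Far s → x ~ a → c a ≡ c s →
               Near t → x ~ g → c g ≡ c t → g ≢ t → a ~ g
    far-near {s} {t} {a} {g} ls lt fs@(_ , x≁s) x~a ca nt@(x~t , y≁t) x~g cg g≢t = ¬≁⇒~ λ a≁g →
      let s~g = ¬≁⇒~ λ s≁g → chair (~-sym x~a) x~g (~-sym v~x) v~s a≁g (≁-sym v≁a) a≁s x≁s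
                               (≁-sym v≁g) (≁-sym s≁g) a≢g
      in chair (~-sym x~a) x~t x~g (~-sym s~g) (≁-sym t≁a) a≁g a≁s x≁s t≁g t≁s
           (≢-sym (separated (~-sym v~t) (≁-sym v≁a)))
      where
      v~s : v ~ s
      v~s = proj₁ ls
      v~t : v ~ t
      v~t = proj₁ lt
      s≢t : s ≢ t
      s≢t = ≢-sym (separated (~-sym x~t) (≁-sym x≁s))
      a≢g : a ≢ g
      a≢g = colours-≢ λ eq → lone-colours-≢ ls lt s≢t (trans (sym ca) (trans eq cg))
      v≁a : v ≁ a
      v≁a = far-v≁ ls fs x~a ca
      a≁s : a ≁ s
      a≁s = same-colour-≁ ca
      t≁s : t ≁ s
      t≁s = near-≁-far ls fs lt nt
      t≁a : t ≁ a
      t≁a = near-≁-rep ls fs x~a ca lt nt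
      v≁g : v ≁ g
      v≁g = lone-≁ lt cg g≢t
      t≁g : t ≁ g
      t≁g = same-colour-≁ (sym cg)

    -- Otherwise `t` hangs at `v` on the diamond with spine `y w` and tips `g`, `v`. In `near-near`
    -- and `both-near`, a missing edge at `g` would make every far lone vertex see `g`, in
    -- particular `y` and `w`.
    near-misses-y-or-w : ∀ {t g} → Lone c t → Near t → c g ≡ c t → g ≢ t → y ~ g → w ~ g → ⊥
    near-misses-y-or-w {t} {g} lt nt@(_ , y≁t) cg g≢t y~g w~g = kite y~w y~g (~-sym v~y)
                                                                  (~-sym v~t) w~g (~-sym v~w)
                                                                  y≁t t≁w t≁g (≁-sym v≁g)
      where
      v~t : v ~ t
      v~t = proj₁ lt
      v≁g : v ≁ g
      v≁g = lone-≁ lt cg g≢t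
      t≁g : t ≁ g
      t≁g = same-colour-≁ (sym cg)
      t≁w : t ≁ w
      t≁w = near-≁-far lw (x≢w , x≁w) lt nt

    -- Let `g ≁ g′`. If a far `s` misses `g` but sees `g′`, it hangs at `g′` on the diamond with
    -- spine `x a`; if it misses both, `g` and `g′` are the leaves of a chair with path `x`, `v`,
    -- `s`.
    near-near : ∀ {t t′ g g′} → Lone c t → Lone c t′ → t ≢ t′ → Near t → x ~ g → c g ≡ c t → g ≢ t →
                Near t′ → x ~ g′ → c g′ ≡ c t′ → g′ ≢ t′ → g ~ g′
    near-near {t} {t′} {g} {g′} lt lt′ t≢t′ nt x~g cg g≢t nt′ x~g′ cg′ g′≢t′ = ¬≁⇒~ λ g≁g′ →
      let sees-g : ∀ {s} → Lone c s → Far s → s ~ g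
          sees-g {s} = λ ls fs@(x≢s , x≁s) →
            let open Mate (mate lx ls x≢s x≁s) using () renaming
                  (p to a; x~p to x~a; cp to ca; y≁p to s≁a)
                v~s = proj₁ ls
                a~g = far-near ls lt fs x~a ca nt x~g cg g≢t
                a~g′ = far-near ls lt′ fs x~a ca nt′ x~g′ cg′ g′≢t′
            in ¬≁⇒~ λ s≁g → case ~-or-≁ s g′ of λ
                { (inj₁ s~g′) → kite x~a x~g x~g′ s~g′ a~g a~g′ x≁s s≁a s≁g g≁g′
                ; (inj₂ s≁g′) → chair (~-sym x~g) x~g′ (~-sym v~x) v~s g≁g′ (≁-sym v≁g)
                                  (≁-sym s≁g) x≁s (≁-sym v≁g′) (≁-sym s≁g′) g≢g′ }
      in near-misses-y-or-w lt nt cg g≢t (sees-g ly (x≢y , x≁y)) (sees-g lw (x≢w , x≁w))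
      where
      v≁g : v ≁ g
      v≁g = lone-≁ lt cg g≢t
      v≁g′ : v ≁ g′
      v≁g′ = lone-≁ lt′ cg′ g′≢t′
      g≢g′ : g ≢ g′
      g≢g′ = colours-≢ λ eq → lone-colours-≢ lt lt′ t≢t′ (trans (sym cg) (trans eq cg′))

    both-far : ∀ {i s a} → Lone c i → Lone c s → Both i → Far s → x ~ a → c a ≡ c s → i ~ a
    both-far li ls bi@(x~i , _) fs@(_ , x≁s) x~a ca =
      mate-~ v~x (proj₁ ls) (proj₁ li) x~a (far-v≁ ls fs x~a ca) (same-colour-≁ (sym ca)) x≁s
             (~-sym x~i) (both-~-far ls fs li bi)

    both-near : ∀ {i t g} → Lone c i → Lone c t → Both i → Near t → x ~ g → c g ≡ c t → g ≢ t → i ~ g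
    both-near {i} {t} {g} li lt bi@(x~i , _) nt x~g cg g≢t = ¬≁⇒~ λ i≁g →
      let sees-g : ∀ {s} → Lone c s → Far s → s ~ g
          sees-g {s} = λ ls fs@(x≢s , x≁s) →
            let open Mate (mate lx ls x≢s x≁s) using () renaming
                  (p to a; x~p to x~a; cp to ca; y≁p to s≁a)
                a~g = far-near ls lt fs x~a ca nt x~g cg g≢t
                i~a = both-far li ls bi fs x~a ca
                i~s = both-~-far ls fs li bi
            in ¬≁⇒~ λ s≁g → kite x~a x~g x~i (~-sym i~s) a~g (~-sym i~a) x≁s s≁a s≁g (≁-sym i≁g)
      in near-misses-y-or-w lt nt cg g≢t (sees-g ly (x≢y , x≁y)) (sees-g lw (x≢w , x≁w))

    both-both : ∀ {i j} → Lone c i → Lone c j → i ≢ j → Both i → Both j → i ~ j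
    both-both li lj i≢j (x~i , y~i) (x~j , y~j) = ¬≁⇒~ λ i≁j →
      no-lone-C4 lx ly li lj x≢y i≢j x≁y i≁j x~i x~j y~i y~j

    representatives-~ : ∀ {s s′ a a′} → Lone c s → Lone c s′ → s ≢ s′ → Rep s a → Rep s′ a′ → a ~ a′
    representatives-~ ls ls′ s≢s′ (itself refl) (itself refl)     = contradiction refl s≢s′
    representatives-~ ls ls′ s≢s′ (itself refl) (far _ x~a _)     = x~a
    representatives-~ ls ls′ s≢s′ (itself refl) (near _ x~a _ _)  = x~a
    representatives-~ ls ls′ s≢s′ (itself refl) (both (x~s , _))  = x~s
    representatives-~ ls ls′ s≢s′ (far _ x~a _) (itself refl)     = ~-sym x~a
    representatives-~ ls ls′ s≢s′ (near _ x~a _ _) (itself refl)  = ~-sym x~a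
    representatives-~ ls ls′ s≢s′ (both (x~s , _)) (itself refl)  = ~-sym x~s
    representatives-~ ls ls′ s≢s′ (far f e q) (far f′ e′ q′)      = far-far ls ls′ s≢s′ f e q f′ e′ q′
    representatives-~ ls ls′ s≢s′ (far f e q) (near n e′ q′ d)    = far-near ls ls′ f e q n e′ q′ d
    representatives-~ ls ls′ s≢s′ (near n e′ q′ d) (far f e q)    = ~-sym (far-near ls′ ls f e q n e′ q′ d)
    representatives-~ ls ls′ s≢s′ (near n e q d) (near n′ e′ q′ d′) = near-near ls ls′ s≢s′ n e q d n′ e′ q′ d′
    representatives-~ ls ls′ s≢s′ (both b) (far f e q)            = both-far ls ls′ b f e q
    representatives-~ ls ls′ s≢s′ (far f e q) (both b)            = ~-sym (both-far ls′ ls b f e q)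
    representatives-~ ls ls′ s≢s′ (both b) (near n e q d)         = both-near ls ls′ b n e q d
    representatives-~ ls ls′ s≢s′ (near n e q d) (both b)         = ~-sym (both-near ls′ ls b n e q d)
    representatives-~ ls ls′ s≢s′ (both b) (both b′)              = both-both ls ls′ s≢s′ b b′

  -- Counting lone colours, and the non-edges between lone vertices.

  module Counting {Δ ω} (degree≤ : degree G v ≤ Δ) (clique≤ : ∀ S → IsClique G S → ∣ S ∣ ≤ ω)
                  (bound : Δ + ω + 1 ≤ k + k) where

    clique-length≤ : ∀ {A : Set} {is : List A} (f : A → Fin m) → Unique is →
                     (∀ {i j} → i ∈ is → j ∈ is → i ≢ j → f i ~ f j) → length is ≤ ω
    clique-length≤ {is = is} f unique clique = begin
      length is          ≡⟨ length-map f is ⟨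
      length (map f is)  ≤⟨ length≤∣p∣ S (unique-map f (λ i∈ j∈ i≢j → ~⇒≢ (clique i∈ j∈ i≢j)) unique)
                                       (λ a∈ → ∈-tabulate-true _ (dec-true (_ ∈? map f is) a∈)) ⟩
      ∣ S ∣              ≤⟨ clique≤ S S-clique ⟩
      ω                  ∎
      where
      open ≤-Reasoning
      S : Subset m
      S = tabulate (λ a → does (a ∈? map f is))
      S⇒image : ∀ {a} → a ∈ₛ S → a ∈ map f is
      S⇒image {a} a∈S with a ∈? map f is
        | trans (sym (lookup∘tabulate (λ b → does (b ∈? map f is)) a)) ([]=⇒lookup a∈S)
      ... | yes a∈ | _ = a∈
      S-clique : IsClique G S
      S-clique a b a∈S b∈S a≢b with ∈-map⁻ f (S⇒image a∈S) | ∈-map⁻ f (S⇒image b∈S)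
      ... | i , i∈ , refl | j , j∈ , refl = clique i∈ j∈ λ { refl → a≢b refl }

    -- The index `j` stands for the nonzero colour `suc j`. Uniqueness suffices, as `seen` provides
    -- a neighbour of `v` in each such colour.
    LoneColour : Fin k → Set
    LoneColour j = ∀ a b → v ~ a → c a ≡ suc j → v ~ b → c b ≡ suc j → a ≡ b

    lone-colour? : Decidable LoneColour
    lone-colour? j = all? λ a → all? λ b →
      (v ~? a) →-dec (c a ≟ suc j) →-dec (v ~? b) →-dec (c b ≟ suc j) →-dec (a ≟ b)

    seen : ∀ j → ∃ λ a → v ~ a × c a ≡ suc j
    seen j = every-colour-seen solo (suc j) (λ ())

    nbr : Fin k → Fin m
    nbr j = proj₁ (seen j)

    v~nbr : ∀ j → v ~ nbr j
    v~nbr j = proj₁ (proj₂ (seen j))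

    c-nbr : ∀ j → c (nbr j) ≡ suc j
    c-nbr j = proj₂ (proj₂ (seen j))

    nbr-injective : ∀ {i j} → nbr i ≡ nbr j → i ≡ j
    nbr-injective {i} {j} eq = suc-injective (trans (sym (c-nbr i)) (trans (cong c eq) (c-nbr j)))

    Another : Fin k → Fin m → Set
    Another j a = v ~ a × c a ≡ suc j × a ≢ nbr j

    another? : ∀ j → Dec (∃ (Another j))
    another? j = any? λ a → (v ~? a) ×-dec (c a ≟ suc j) ×-dec ¬? (a ≟ nbr j)

    -- The value v is junk, taken when the colour j is lone.
    another : Fin k → Fin m
    another j with another? j
    ... | yes (a , _) = a
    ... | no _        = v

    another-spec : ∀ {j} → ¬ LoneColour j → Another j (another j)
    another-spec {j} ¬lone with another? j
    ... | yes (_ , p) = p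
    ... | no none     = contradiction lone ¬lone
      where
      is-nbr : ∀ a → v ~ a → c a ≡ suc j → a ≡ nbr j
      is-nbr a v~a ca = decidable-stable (a ≟ nbr j) λ a≢ → none (a , v~a , ca , a≢)
      lone : LoneColour j
      lone a b v~a ca v~b cb = trans (is-nbr a v~a ca) (sym (is-nbr b v~b cb))

    lones others : List (Fin k)
    lones  = filter lone-colour? (allFin k)
    others = filter (¬? ∘ lone-colour?) (allFin k)

    lones-unique : Unique lones
    lones-unique = filter⁺ lone-colour? (allFin⁺ k)

    -- Each of the `k` colours has a neighbour of `v`, and each colour that is not lone has a
    -- further one.
    k+others≤Δ : k + length others ≤ Δ
    k+others≤Δ = begin
      k + length others
        ≡⟨ cong (_+ length others) (length-tabulate {n = k} id) ⟨
      length (allFin k) + length others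
        ≡⟨ cong₂ _+_ (length-map nbr (allFin k)) (length-map another others) ⟨
      length (map nbr (allFin k)) + length (map another others)
        ≡⟨ length-++ (map nbr (allFin k)) ⟨
      length nbrs
        ≤⟨ length≤∣p∣ (nbhd G v) nbrs-unique (∈-tabulate-true _ ∘ v~nbrs) ⟩
      degree G v
        ≤⟨ degree≤ ⟩
      Δ ∎
      where
      open ≤-Reasoning
      nbrs : List (Fin m)
      nbrs = map nbr (allFin k) ++ map another others
      spec : ∀ {j} → j ∈ others → Another j (another j)
      spec j∈ = another-spec (proj₂ (∈-filter⁻ (¬? ∘ lone-colour?) {xs = allFin k} j∈))
      another-colour : ∀ {i j} → i ∈ others → j ∈ others → another i ≡ another j → i ≡ j
      another-colour i∈ j∈ eq = suc-injective
        (trans (sym (proj₁ (proj₂ (spec i∈)))) (trans (cong c eq) (proj₁ (proj₂ (spec j∈)))))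
      nbrs-unique : Unique nbrs
      nbrs-unique = ++⁺ (map⁺ nbr-injective (allFin⁺ k))
        (unique-map another (λ i∈ j∈ i≢j eq → i≢j (another-colour i∈ j∈ eq))
                    (filter⁺ (¬? ∘ lone-colour?) (allFin⁺ k)))
        disjoint
        where
        disjoint : ∀ {a} → ¬ (a ∈ map nbr (allFin k) × a ∈ map another others)
        disjoint (p , q) with ∈-map⁻ nbr p | ∈-map⁻ another q
        ... | i , _ , refl | j , j∈ , eq with spec j∈
        ...   | _ , cj , ≢nbr with suc-injective (trans (sym (c-nbr i)) (trans (cong c eq) cj))
        ...     | refl = ≢nbr (sym eq)
      v~nbrs : ∀ {a} → a ∈ nbrs → v ~ a
      v~nbrs a∈ with ∈-++⁻ (map nbr (allFin k)) a∈
      ... | inj₁ p with ∈-map⁻ nbr p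
      ...   | j , _ , refl = v~nbr j
      v~nbrs a∈ | inj₂ q with ∈-map⁻ another q
      ...   | j , j∈ , refl = proj₁ (spec j∈)

    -- Add `ω + 1` to `k+others≤Δ` and compare with `k + k`, where the second `k` counts the lone
    -- and the other colours.
    ω<lones : ω < length lones
    ω<lones = +-cancelˡ-≤ (k + length others) _ _ (begin
      k + length others + suc ω            ≤⟨ +-monoˡ-≤ (suc ω) k+others≤Δ ⟩
      Δ + suc ω                            ≡⟨ cong (Δ +_) (+-comm 1 ω) ⟩
      Δ + (ω + 1)                          ≡⟨ +-assoc Δ ω 1 ⟨
      Δ + ω + 1                            ≤⟨ bound ⟩
      k + k                                ≡⟨ cong (k +_) lones+others≡k ⟨
      k + (length lones + length others)   ≡⟨ cong (k +_) (+-comm (length lones) (length others)) ⟩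
      k + (length others + length lones)   ≡⟨ +-assoc k (length others) (length lones) ⟨
      k + length others + length lones     ∎)
      where
      open ≤-Reasoning
      lones+others≡k : length lones + length others ≡ k
      lones+others≡k = trans (length-filter-split lone-colour? (allFin k)) (length-tabulate {n = k} id)

    no-lone-clique : (f : Fin k → Fin m) → ¬ (∀ {i j} → i ∈ lones → j ∈ lones → i ≢ j → f i ~ f j)
    no-lone-clique f clique = <⇒≱ ω<lones (clique-length≤ f lones-unique clique)

    lone : ∀ {j} → j ∈ lones → Lone c (nbr j)
    lone {j} j∈ = v~nbr j , λ {a} v~a eq →
      proj₂ (∈-filter⁻ lone-colour? {xs = allFin k} j∈) a (nbr j) v~a (trans eq (c-nbr j)) (v~nbr j) (c-nbr j)

    -- Put v in the place of the lone vertex of colour o.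
    no-lone-clique-but-one : ∀ o →
      ¬ (∀ {i j} → i ∈ lones → j ∈ lones → i ≢ o → j ≢ o → i ≢ j → nbr i ~ nbr j)
    no-lone-clique-but-one o clique = no-lone-clique f f-clique
      where
      f : Fin k → Fin m
      f j = if does (j ≟ o) then v else nbr j
      f-clique : ∀ {i j} → i ∈ lones → j ∈ lones → i ≢ j → f i ~ f j
      f-clique {i} {j} i∈ j∈ i≢j with i ≟ o | j ≟ o
      ... | yes refl | yes refl = contradiction refl i≢j
      ... | yes _    | no _     = v~nbr j
      ... | no _     | yes _    = ~-sym (v~nbr i)
      ... | no i≢o   | no j≢o   = clique i∈ j∈ i≢o j≢o i≢j

    no-two-edges : ∀ {x z y w} → Lone c x → Lone c z → Lone c y → Lone c w →
                   x ~ z → y ~ w → x ≁ y → x ≁ w → z ≁ y → z ≁ w → ⊥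
    no-two-edges lx lz ly lw x~z y~w x≁y x≁w z≁y z≁w = no-lone-clique f λ i∈ j∈ i≢j →
        representatives-~ (lone i∈) (lone j∈) (i≢j ∘ nbr-injective) (f-rep i∈) (f-rep j∈)
      where
      open TwoEdges lx lz ly lw x~z y~w x≁y x≁w z≁y z≁w
      f : Fin k → Fin m
      f j with j ∈? lones
      ... | yes j∈ = proj₁ (representative (lone j∈))
      ... | no _   = v
      f-rep : ∀ {j} → j ∈ lones → Rep (nbr j) (f j)
      f-rep {j} j∈ with j ∈? lones
      ... | yes j∈′ = proj₂ (representative (lone j∈′))
      ... | no j∉   = contradiction j∈ j∉

    -- The four cross pairs decide: two non-edges that meet give an independent triple, two that do
    -- not give two disjoint edges, a single one gives an induced P4, and none an induced C4.
    no-disjoint-nonedges : ∀ {x y u w} → Lone c x → Lone c y → Lone c u → Lone c w →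
      x ≢ y → u ≢ w → x ≢ u → x ≢ w → y ≢ u → y ≢ w → x ≁ y → u ≁ w → ⊥
    no-disjoint-nonedges {x} {y} {u} {w} lx ly lu lw x≢y u≢w x≢u x≢w y≢u y≢w x≁y u≁w
      with ~-or-≁ x u | ~-or-≁ x w | ~-or-≁ y u | ~-or-≁ y w
    ... | inj₂ x≁u | inj₂ x≁w | _ | _ = no-lone-triple lx lu lw x≢u x≢w u≢w x≁u x≁w u≁w
    ... | inj₂ x≁u | inj₁ x~w | inj₂ y≁u | _ = no-lone-triple lx ly lu x≢y x≢u y≢u x≁y x≁u y≁u
    ... | inj₂ x≁u | inj₁ x~w | inj₁ y~u | inj₂ y≁w =
      no-two-edges lx lw ly lu x~w y~u x≁y x≁u (≁-sym y≁w) (≁-sym u≁w)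
    ... | inj₂ x≁u | inj₁ x~w | inj₁ y~u | inj₁ y~w =
      no-lone-P4 lu ly lw lx (~-sym y~u) y~w (~-sym x~w) u≁w (≁-sym x≁u) (≁-sym x≁y)
    ... | inj₁ x~u | inj₂ x≁w | _ | inj₂ y≁w = no-lone-triple lx ly lw x≢y x≢w y≢w x≁y x≁w y≁w
    ... | inj₁ x~u | inj₂ x≁w | inj₂ y≁u | inj₁ y~w =
      no-two-edges lx lu ly lw x~u y~w x≁y x≁w (≁-sym y≁u) u≁w
    ... | inj₁ x~u | inj₂ x≁w | inj₁ y~u | inj₁ y~w =
      no-lone-P4 lw ly lu lx (~-sym y~w) y~u (~-sym x~u) (≁-sym u≁w) (≁-sym x≁w) (≁-sym x≁y)
    ... | inj₁ x~u | inj₁ x~w | inj₂ y≁u | inj₂ y≁w = no-lone-triple ly lu lw y≢u y≢w u≢w y≁u y≁w u≁w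
    ... | inj₁ x~u | inj₁ x~w | inj₂ y≁u | inj₁ y~w =
      no-lone-P4 lu lx lw ly (~-sym x~u) x~w (~-sym y~w) u≁w (≁-sym y≁u) x≁y
    ... | inj₁ x~u | inj₁ x~w | inj₁ y~u | inj₂ y≁w =
      no-lone-P4 lw lx lu ly (~-sym x~w) x~u (~-sym y~u) (≁-sym u≁w) (≁-sym y≁w) x≁y
    ... | inj₁ x~u | inj₁ x~w | inj₁ y~u | inj₁ y~w =
      no-lone-C4 lx ly lu lw x≢y u≢w x≁y u≁w x~u x~w y~u y~w

    disjoint : ∀ {a b i j} → a ∈ lones → b ∈ lones → i ∈ lones → j ∈ lones →
               a ≢ b → i ≢ j → a ≢ i → a ≢ j → b ≢ i → b ≢ j → nbr a ≁ nbr b → nbr i ≁ nbr j → ⊥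
    disjoint a∈ b∈ i∈ j∈ a≢b i≢j a≢i a≢j b≢i b≢j =
      no-disjoint-nonedges (lone a∈) (lone b∈) (lone i∈) (lone j∈) (≢nbr a≢b) (≢nbr i≢j)
        (≢nbr a≢i) (≢nbr a≢j) (≢nbr b≢i) (≢nbr b≢j)
      where
      ≢nbr : ∀ {i j} → i ≢ j → nbr i ≢ nbr j
      ≢nbr i≢j = i≢j ∘ nbr-injective

    -- Some non-edge avoids `b`. It must meet the non-edge `a b`, so it ends in `a`, and also `b d`,
    -- so it is `a d`; this completes an independent triple.
    no-two-nonedges-at : ∀ {a b d} → a ∈ lones → b ∈ lones → d ∈ lones → a ≢ b → a ≢ d → b ≢ d →
                         nbr a ≁ nbr b → nbr b ≁ nbr d → ⊥
    no-two-nonedges-at {a} {b} {d} a∈ b∈ d∈ a≢b a≢d b≢d a≁b b≁d =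
      no-lone-clique-but-one b λ {i} {j} i∈ j∈ i≢b j≢b i≢j → ¬≁⇒~ λ i≁j → meets i∈ j∈ i≢b j≢b i≢j i≁j
      where
      at-a : ∀ {e} → e ∈ lones → e ≢ b → a ≢ e → nbr a ≁ nbr e → ⊥
      at-a {e} e∈ e≢b a≢e a≁e with e ≟ d
      ... | yes refl = no-lone-triple (lone a∈) (lone b∈) (lone d∈) (a≢b ∘ nbr-injective)
                         (a≢d ∘ nbr-injective) (b≢d ∘ nbr-injective) a≁b a≁e b≁d
      ... | no e≢d   = disjoint b∈ d∈ a∈ e∈ b≢d a≢e (≢-sym a≢b) (≢-sym e≢b) (≢-sym a≢d) (≢-sym e≢d) b≁d a≁e
      meets : ∀ {i j} → i ∈ lones → j ∈ lones → i ≢ b → j ≢ b → i ≢ j → nbr i ≁ nbr j → ⊥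
      meets {i} {j} i∈ j∈ i≢b j≢b i≢j i≁j with i ≟ a | j ≟ a
      ... | yes refl | _      = at-a j∈ j≢b i≢j i≁j
      ... | no _ | yes refl   = at-a i∈ i≢b (≢-sym i≢j) (≁-sym i≁j)
      ... | no i≢a | no j≢a   = disjoint a∈ b∈ i∈ j∈ a≢b i≢j (≢-sym i≢a) (≢-sym j≢a) (≢-sym i≢b) (≢-sym j≢b) a≁b i≁j

    -- Some non-edge avoids `a`. It must meet `a b`, so there are two non-edges at `b`.
    no-nonedge : ∀ {a b} → a ∈ lones → b ∈ lones → a ≢ b → nbr a ≁ nbr b → ⊥
    no-nonedge {a} {b} a∈ b∈ a≢b a≁b =
      no-lone-clique-but-one a λ i∈ j∈ i≢a j≢a i≢j → ¬≁⇒~ λ i≁j → meets i∈ j∈ i≢a j≢a i≢j i≁j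
      where
      meets : ∀ {i j} → i ∈ lones → j ∈ lones → i ≢ a → j ≢ a → i ≢ j → nbr i ≁ nbr j → ⊥
      meets {i} {j} i∈ j∈ i≢a j≢a i≢j i≁j with i ≟ b | j ≟ b
      ... | yes refl | _    = no-two-nonedges-at a∈ b∈ j∈ a≢b (≢-sym j≢a) i≢j a≁b i≁j
      ... | no _ | yes refl = no-two-nonedges-at a∈ b∈ i∈ a≢b (≢-sym i≢a) (≢-sym i≢j) a≁b (≁-sym i≁j)
      ... | no i≢b | no j≢b = disjoint a∈ b∈ i∈ j∈ a≢b i≢j (≢-sym i≢a) (≢-sym j≢a) (≢-sym i≢b) (≢-sym j≢b) a≁b i≁j

    contradictory : ⊥
    contradictory = no-lone-clique nbr λ i∈ j∈ i≢j → ¬≁⇒~ (no-nonedge i∈ j∈ i≢j)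

-- Decidability of colourability, and induction by deleting a vertex.

-- The hypothesis `ext` stands in for function extensionality: a function agrees only pointwise with
-- the one rebuilt from its head and tail.
any-function? : ∀ {n k} {P : (Fin n → Fin k) → Set} → (∀ {f g} → (∀ i → f i ≡ g i) → P f → P g) →
                Decidable P → Dec (∃ P)
any-function? {zero} {P = P} ext P? with P? (λ ())
... | yes p = yes (_ , p)
... | no ¬p = no λ (_ , p) → ¬p (ext (λ ()) p)
any-function? {suc n} {P = P} ext P? with
  any? (λ κ → any-function? {P = λ f → P (κ ∷ᶠ f)} (λ eq → ext λ { zero → refl ; (suc i) → eq i }) (λ f → P? (κ ∷ᶠ f)))
... | yes (κ , f , p) = yes (κ ∷ᶠ f , p)
... | no none = no λ (f , p) → none (f zero , f ∘ suc , ext (λ { zero → refl ; (suc i) → refl }) p)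

-- This lets the argument by contradiction end in an actual colouring.
colourable? : ∀ {n} (G : Graph n) k → Dec (Colourable G k)
colourable? G k = any-function?
  (λ eq proper u v u~v fu≡fv → proper u v u~v (trans (eq u) (trans fu≡fv (sym (eq v)))))
  (λ f → all? λ u → all? λ v → (adj G u v ≟ᵇ true) →-dec ¬? (f u ≟ f v))

delete-zero : ∀ {n} → Graph (suc n) → Graph n
delete-zero G = record
  { adj        = λ u v → adj G (suc u) (suc v)
  ; adj-sym    = λ u v → adj-sym G (suc u) (suc v)
  ; adj-irrefl = λ v → adj-irrefl G (suc v) }

delete-zero-induced : ∀ {n} (G : Graph (suc n)) {H} → HasInduced (delete-zero G) H → HasInduced G H
delete-zero-induced G (f , f-inj , f-adj) = suc ∘ f , f-inj ∘ suc-injective , f-adj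

∣p∣≤∣x∷p∣ : ∀ {n} b (p : Subset n) → ∣ p ∣ ≤ ∣ b ∷ᵛ p ∣
∣p∣≤∣x∷p∣ true p  = n≤1+n ∣ p ∣
∣p∣≤∣x∷p∣ false p = ≤-refl

delete-zero-degree : ∀ {n} (G : Graph (suc n)) u → degree (delete-zero G) u ≤ degree G (suc u)
delete-zero-degree G u = ∣p∣≤∣x∷p∣ (adj G (suc u) zero) (nbhd (delete-zero G) u)

delete-zero-clique : ∀ {n} (G : Graph (suc n)) S → IsClique (delete-zero G) S → IsClique G (false ∷ᵛ S)
delete-zero-clique G S clique (suc u) (suc w) (there u∈) (there w∈) u≢w =
  clique u w u∈ w∈ (u≢w ∘ cong suc)

-- The numbers `Δ` and `ω` are mere upper bounds, so that they and `k` stay the same when vertex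
-- zero is deleted in the induction on `n`.
colourable-by-bounds : ∀ {n} (G : Graph n) {k Δ ω} → (∀ u → degree G u ≤ Δ) →
  (∀ S → IsClique G S → ∣ S ∣ ≤ ω) → Δ + ω + 1 ≤ k + k →
  ¬ HasInduced G chairAdj → ¬ HasInduced G kiteAdj → Colourable G k
colourable-by-bounds {zero} G _ _ _ _ _ = (λ ()) , λ ()
colourable-by-bounds {suc n} G {k} degree≤ clique≤ bound no-chair no-kite
  with colourable-by-bounds (delete-zero G)
         (λ u → ≤-trans (delete-zero-degree G u) (degree≤ (suc u)))
         (λ S clique → clique≤ (false ∷ᵛ S) (delete-zero-clique G S clique)) bound
         (no-chair ∘ delete-zero-induced G) (no-kite ∘ delete-zero-induced G)
... | f , f-proper = decidable-stable (colourable? G k) λ uncolourable →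
        Local.Counting.contradictory G no-chair no-kite uncolourable zero c (solo uncolourable)
          (degree≤ zero) clique≤ bound
  where
  c : Fin (suc n) → Fin (suc k)
  c = zero ∷ᶠ (suc ∘ f)
  c-proper : IsProperColouring G c
  c-proper zero zero e _ = Adjacency.~⇒≢ G e refl
  c-proper (suc u) (suc w) e eq = f-proper u w e (suc-injective eq)
  solo : ∀ uncolourable → Stuck.Solo G uncolourable zero c
  solo _ = record { proper = c-proper ; at-v = refl ; only-v = λ { {zero} _ → refl } }

-- The maximum degree and the rounded bound.

degree≤maxDegree : ∀ {n} (G : Graph n) u → degree G u ≤ maxDegree G
degree≤maxDegree {n} G u = go (∈-allFin u)
  where
  go : ∀ {us} → u ∈ us → degree G u ≤ foldr _⊔_ 0 (map (degree G) us)
  go (here refl)      = m≤m⊔n _ _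
  go (there {w} u∈us) = ≤-trans (go u∈us) (m≤n⊔m (degree G w) _)

n≤⌈n/2⌉+⌈n/2⌉ : ∀ n → n ≤ ⌈ n /2⌉ + ⌈ n /2⌉
n≤⌈n/2⌉+⌈n/2⌉ n = begin
  n                     ≡⟨ ⌊n/2⌋+⌈n/2⌉≡n n ⟨
  ⌊ n /2⌋ + ⌈ n /2⌉     ≤⟨ +-monoˡ-≤ ⌈ n /2⌉ (⌊n/2⌋≤⌈n/2⌉ n) ⟩
  ⌈ n /2⌉ + ⌈ n /2⌉     ∎
  where open ≤-Reasoning

theorem2 : ∀ {n} (G : Graph n) (ω : ℕ) → IsCliqueNumber G ω →
    ¬ HasInduced G chairAdj → ¬ HasInduced G kiteAdj →
    Colourable G ⌈ maxDegree G + ω + 1 /2⌉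
theorem2 G ω (_ , clique≤) =
  colourable-by-bounds G (degree≤maxDegree G) clique≤ (n≤⌈n/2⌉+⌈n/2⌉ (maxDegree G + ω + 1))
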